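{- For $i=1,2$ let $\mathcal{G}_i$ be an $r_i$-regular graph with $n_i$ vertices, and let $\mu_{11},\ldots,\mu_{1n_1}$ be the Laplacian eigenvalues of $\mathcal{G}_1$. Then $\mathcal{G}_1\circledast\mathcal{G}_2$ is Laplacian integral if and only if $\mathcal{G}_2$ is Laplacian integral and, for each $i=1,2,\ldots,n_1$, the roots of $x-n_2-n_2\mu_{1i}-n_2\chi_{L_{\mathcal{G}_2}}(x-n_2)$ are integers.
   Context: All graphs are simple, finite and undirected. $L_{\mathcal{G}}=D_{\mathcal{G}}-A_{\mathcal{G}}$ is the Laplacian matrix (degree matrix minus adjacency matrix). A graph is Laplacian integral if all eigenvalues of its Laplacian matrix are integers. The Laplacian coronal of a graph $\mathcal{G}$ on $n$ vertices is the rational function $\chi_{L_{\mathcal{G}}}(x)=\mathbf{1}_n^T(xI_n-L_{\mathcal{G}})^{ -1}\mathbf{1}_n$, $\mathbf{1}_n$ the all-ones vector; "roots" of the expression in the claim are the values of $x$ at which this rational function vanishes. The graph product $\mathcal{G}_1\circledast\mathcal{G}_2$ of $\mathcal{G}_1$ (vertices $u_1,\ldots,u_{n_1}$) and $\mathcal{G}_2$ (vertices $v_1,\ldots,v_{n_2}$) has vertex set $\{a_{ik},b_{ik}:1\le i\le n_1,1\le k\le n_2\}$ and edges: $a_{ik}a_{jl}$ for all $k,l$ whenever $u_iu_j\in E(\mathcal{G}_1)$; $b_{ri}b_{rj}$ for all $r$ whenever $v_iv_j\in E(\mathcal{G}_2)$; $a_{ip}b_{iq}$ for all $i,p,q$.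 -}

module Defs where

open import Algebra.Bundles using (RawRing; CommutativeRing)
import Algebra.Definitions.RawSemiring as RawSemiringDefinitions
open import Data.Bool.Base using (if_then_else_)
open import Data.Fin.Base using (Fin; zero; suc; toℕ; punchIn; splitAt; remQuot)
open import Data.Fin.Properties using (_≟_)
open import Data.Integer.Base using (ℤ; +_; -[1+_])
open import Data.List.Base using (List; []; _∷_; map; _++_)
import Data.Nat.Base as ℕ
open ℕ using (ℕ; zero; suc)
open import Data.Product.Base using (∃; _×_; _,_; uncurry)
open import Data.Sum.Base using (_⊎_; inj₁; inj₂; [_,_]′)
open import Data.Vec.Base using (Vec; toList; count; allFin)
open import Function.Base using (_∘_)
open import Level using (_⊔_; 0ℓ) renaming (suc to lsuc)
open import Relation.Binary.Core using (Rel)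
open import Relation.Binary.Definitions using (Decidable; Symmetric; Irreflexive)
open import Relation.Binary.PropositionalEquality.Core using (_≡_; refl)
open import Relation.Binary.Structures using (IsStrictTotalOrder)
open import Relation.Nullary.Decidable.Core using (yes; no; does)
open import Relation.Nullary.Negation.Core using (¬_)

------------------------------------------------------------------------
-- Graphs

record Graph (n : ℕ) : Set₁ where
  field
    Adjacent    : Rel (Fin n) 0ℓ
    adjacent?   : Decidable Adjacent
    symmetric   : Symmetric Adjacent
    irreflexive : Irreflexive _≡_ Adjacent

degree : ∀ {n} → Graph n → Fin n → ℕ
degree {n} G i = count (Graph.adjacent? G i) (allFin n)

Regular : ∀ {n} → ℕ → Graph n → Set
Regular r G = ∀ i → degree G i ≡ r

module GraphProduct {n₁ n₂ : ℕ} (G₁ : Graph n₁) (G₂ : Graph n₂) where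
  private
    module G₁ = Graph G₁
    module G₂ = Graph G₂

  data Vertex : Set where
    a b : Fin n₁ → Fin n₂ → Vertex

  data Adjacent : Rel Vertex 0ℓ where
    aa : ∀ {i j k l} → G₁.Adjacent i j → Adjacent (a i k) (a j l)
    bb : ∀ {r i j}   → G₂.Adjacent i j → Adjacent (b r i) (b r j)
    ab : ∀ {i p q}   → Adjacent (a i p) (b i q)
    ba : ∀ {i p q}   → Adjacent (b i q) (a i p)

  adjacent? : Decidable Adjacent
  adjacent? (a i k) (a j l) with G₁.adjacent? i j
  ... | yes e = yes (aa e)
  ... | no ¬e = no λ { (aa e) → ¬e e }
  adjacent? (a i p) (b j q) with i ≟ j
  ... | yes refl = yes ab
  ... | no i≢j   = no λ { ab → i≢j refl }
  adjacent? (b i q) (a j p) with i ≟ j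
  ... | yes refl = yes ba
  ... | no i≢j   = no λ { ba → i≢j refl }
  adjacent? (b r i) (b s j) with r ≟ s
  ... | no r≢s   = no λ { (bb _) → r≢s refl }
  ... | yes refl with G₂.adjacent? i j
  ...   | yes e = yes (bb e)
  ...   | no ¬e = no λ { (bb e) → ¬e e }

  symmetric : Symmetric Adjacent
  symmetric (aa e) = aa (G₁.symmetric e)
  symmetric (bb e) = bb (G₂.symmetric e)
  symmetric ab     = ba
  symmetric ba     = ab

  irreflexive : ∀ {v} → ¬ Adjacent v v
  irreflexive (aa e) = G₁.irreflexive refl e
  irreflexive (bb e) = G₂.irreflexive refl e

  -- A bijection: all a's first, then all b's, each in lexicographic order.
  vertex : Fin (n₁ ℕ.* n₂ ℕ.+ n₁ ℕ.* n₂) → Vertex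
  vertex =
    [ uncurry a ∘ remQuot n₂ , uncurry b ∘ remQuot n₂ ]′ ∘ splitAt (n₁ ℕ.* n₂)

infixl 7 _⊛_

_⊛_ : ∀ {n₁ n₂} → Graph n₁ → Graph n₂ → Graph (n₁ ℕ.* n₂ ℕ.+ n₁ ℕ.* n₂)
G₁ ⊛ G₂ = record
  { Adjacent    = λ u v → Adjacent (vertex u) (vertex v)
  ; adjacent?   = λ u v → adjacent? (vertex u) (vertex v)
  ; symmetric   = symmetric
  ; irreflexive = λ { refl → irreflexive }
  }
  where open GraphProduct G₁ G₂

------------------------------------------------------------------------
-- Matrices

module Matrices {c ℓ} (R : RawRing c ℓ) where
  open RawRing R
  open RawSemiringDefinitions rawSemiring using (sum; _^_)

  Matrix : ℕ → ℕ → Set c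
  Matrix m n = Fin m → Fin n → Carrier

  infix 4 _≈ᴹ_
  _≈ᴹ_ : ∀ {m n} → Rel (Matrix m n) ℓ
  A ≈ᴹ B = ∀ i j → A i j ≈ B i j

  diagonal : ∀ {n} → (Fin n → Carrier) → Matrix n n
  diagonal d i j = if does (i ≟ j) then d i else 0#

  identity : ∀ {n} → Matrix n n
  identity = diagonal λ _ → 1#

  infixl 6 _-ᴹ_
  _-ᴹ_ : ∀ {m n} → Matrix m n → Matrix m n → Matrix m n
  (A -ᴹ B) i j = A i j + (- B i j)

  infixl 7 _*ᴹ_ _*ⱽ_
  _*ᴹ_ : ∀ {m n p} → Matrix m n → Matrix n p → Matrix m p
  (A *ᴹ B) i k = sum λ j → A i j * B j k

  _*ⱽ_ : ∀ {m n} → Matrix m n → (Fin n → Carrier) → Fin m → Carrier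
  (A *ⱽ v) i = sum λ j → A i j * v j

  -- 𝟏ᵀ A 𝟏
  entrySum : ∀ {m n} → Matrix m n → Carrier
  entrySum A = sum λ i → sum λ j → A i j

  -- Laplace expansion along the first row.
  det : ∀ {n} → Matrix n n → Carrier
  det {zero}  A = 1#
  det {suc n} A =
    sum λ j → (- 1#) ^ toℕ j * (A zero j * det λ i k → A (suc i) (punchIn j k))

------------------------------------------------------------------------
-- Univariate polynomials, as lists of coefficients with the constant
-- term first. Trailing zeros are allowed, so equality compares
-- coefficients.

module Polynomials {c ℓ} (R : RawRing c ℓ) where
  open RawRing R

  Polynomial : Set c
  Polynomial = List Carrier

  coeff : Polynomial → ℕ → Carrier
  coeff []      _       = 0#
  coeff (a ∷ p) zero    = a
  coeff (a ∷ p) (suc k) = coeff p k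

  infix 4 _≈ᴾ_
  _≈ᴾ_ : Rel Polynomial ℓ
  p ≈ᴾ q = ∀ k → coeff p k ≈ coeff q k

  infixl 6 _+ᴾ_
  _+ᴾ_ : Polynomial → Polynomial → Polynomial
  []      +ᴾ q       = q
  (a ∷ p) +ᴾ []      = a ∷ p
  (a ∷ p) +ᴾ (b ∷ q) = a + b ∷ p +ᴾ q

  infixl 7 _*ᴾ_
  _*ᴾ_ : Polynomial → Polynomial → Polynomial
  []      *ᴾ q = []
  (a ∷ p) *ᴾ q = map (a *_) q +ᴾ (0# ∷ p *ᴾ q)

  constᴾ : Carrier → Polynomial
  constᴾ a = a ∷ []

  Xᴾ : Polynomial
  Xᴾ = 0# ∷ 1# ∷ []

  eval : Polynomial → Carrier → Carrier
  eval []      x = 0#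
  eval (a ∷ p) x = a + x * eval p x

  polynomialRing : RawRing c ℓ
  polynomialRing = record
    { Carrier = Polynomial
    ; _≈_     = _≈ᴾ_
    ; _+_     = _+ᴾ_
    ; _*_     = _*ᴾ_
    ; -_      = map -_
    ; 0#      = []
    ; 1#      = constᴾ 1#
    }

------------------------------------------------------------------------
-- Real closed fields with a decidable order, standing in for ℝ: by
-- the spectral theorem, a symmetric matrix over such a field has all of
-- its eigenvalues there.

record RealClosedField c ℓ₁ ℓ₂ : Set (lsuc (c ⊔ ℓ₁ ⊔ ℓ₂)) where
  field
    commutativeRing : CommutativeRing c ℓ₁

  open CommutativeRing commutativeRing public
    hiding (zero) renaming (refl to ≈-refl; sym to ≈-sym; trans to ≈-trans)
  open Polynomials rawRing using (eval)

  infix 4 _<_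
  field
    _<_                : Rel Carrier ℓ₂
    isStrictTotalOrder : IsStrictTotalOrder _≈_ _<_
    0<1                : 0# < 1#
    +-monoˡ-<          : ∀ {x y} z → x < y → x + z < y + z
    *-pos              : ∀ {x y} → 0# < x → 0# < y → 0# < x * y
    inverse            : ∀ x → x ≉ 0# → ∃ λ y → x * y ≈ 1#
    squareRoot         : ∀ x → 0# < x → ∃ λ y → y * y ≈ x
    -- The polynomials below are exactly the monic ones of odd degree.
    oddRoot            : ∀ k (as : Vec Carrier (suc (2 ℕ.* k))) →
                         ∃ λ x → eval (toList as ++ 1# ∷ []) x ≈ 0#

  open IsStrictTotalOrder isStrictTotalOrder public
    using (compare; _<?_; irrefl) renaming (_≟_ to _≈?_; trans to <-trans)

  1≉0 : 1# ≉ 0#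
  1≉0 1≈0 = irrefl (≈-sym 1≈0) 0<1

------------------------------------------------------------------------

module Spectral {c ℓ₁ ℓ₂} (K : RealClosedField c ℓ₁ ℓ₂) where
  open RealClosedField K
  open RawSemiringDefinitions (RawRing.rawSemiring rawRing)
    using () renaming (_×_ to _·_)
  open Polynomials rawRing public
  open Matrices rawRing public

  fromℕ : ℕ → Carrier
  fromℕ n = n · 1#

  fromℤ : ℤ → Carrier
  fromℤ (+ n)    = fromℕ n
  fromℤ -[1+ n ] = - fromℕ (suc n)

  IsInteger : Carrier → Set ℓ₁
  IsInteger x = ∃ λ z → x ≈ fromℤ z

  ----------------------------------------------------------------------
  -- Rational functions

  private
    coeff-+ᴾ : ∀ p q k → coeff (p +ᴾ q) k ≈ coeff p k + coeff q k
    coeff-+ᴾ []      q       k       = ≈-sym (+-identityˡ _)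
    coeff-+ᴾ (a ∷ p) []      k       = ≈-sym (+-identityʳ _)
    coeff-+ᴾ (a ∷ p) (b ∷ q) zero    = ≈-refl
    coeff-+ᴾ (a ∷ p) (b ∷ q) (suc k) = coeff-+ᴾ p q k

    coeff-map : ∀ a q k → coeff (map (a *_) q) k ≈ a * coeff q k
    coeff-map a []      k       = ≈-sym (zeroʳ a)
    coeff-map a (b ∷ q) zero    = ≈-refl
    coeff-map a (b ∷ q) (suc k) = coeff-map a q k

    coeff-∷* : ∀ a p q k →
               coeff ((a ∷ p) *ᴾ q) k ≈ a * coeff q k + coeff (0# ∷ p *ᴾ q) k
    coeff-∷* a p q k = ≈-trans (coeff-+ᴾ (map (a *_) q) _ k) (+-congʳ (coeff-map a q k))

    *-cancel-0 : ∀ {x y} → x ≉ 0# → x * y ≈ 0# → y ≈ 0#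
    *-cancel-0 {x} {y} x≉0 xy≈0 with inverse x x≉0
    ... | z , xz≈1 =
      ≈-trans (≈-sym (*-identityˡ y))
      (≈-trans (*-congʳ (≈-trans (≈-sym xz≈1) (*-comm x z)))
      (≈-trans (*-assoc z x y)
      (≈-trans (*-congˡ xy≈0) (zeroʳ z))))

    -- p * (b ∷ q) = b p + X (p * q); with b = 0 only the shift remains.
    *-shift : ∀ p {b} q → b ≈ 0# →
              ∀ k → coeff (p *ᴾ (b ∷ q)) k ≈ coeff (0# ∷ p *ᴾ q) k
    *-shift []      q b≈0 zero    = ≈-refl
    *-shift []      q b≈0 (suc k) = ≈-refl
    *-shift (a ∷ p) {b} q b≈0 zero =
      ≈-trans (coeff-∷* a p (b ∷ q) zero)
      (≈-trans (+-identityʳ _) (≈-trans (*-congˡ b≈0) (zeroʳ a)))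
    *-shift (a ∷ p) {b} q b≈0 (suc k) =
      ≈-trans (coeff-∷* a p (b ∷ q) (suc k))
      (≈-trans (+-congˡ (*-shift p q b≈0 k))
               (≈-sym (coeff-∷* a p q k)))

    cancelˡ : ∀ {a} p q → a ≉ 0# → ((a ∷ p) *ᴾ q) ≈ᴾ [] → q ≈ᴾ []
    cancelˡ p []      a≉0 pq≈0 k = ≈-refl
    cancelˡ {a} p (b ∷ q) a≉0 pq≈0 =
      λ { zero → b≈0 ; (suc k) → cancelˡ p q a≉0 pq′≈0 k }
      where
      b≈0 : b ≈ 0#
      b≈0 = *-cancel-0 a≉0
        (≈-trans (≈-sym (+-identityʳ _))
        (≈-trans (≈-sym (coeff-∷* a p (b ∷ q) zero)) (pq≈0 zero)))

      pq′≈0 : ((a ∷ p) *ᴾ q) ≈ᴾ []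
      pq′≈0 k = ≈-trans (≈-sym (*-shift (a ∷ p) q b≈0 (suc k))) (pq≈0 (suc k))

    noZeroDivisors : ∀ p q → (p *ᴾ q) ≈ᴾ [] → (p ≈ᴾ []) ⊎ (q ≈ᴾ [])
    noZeroDivisors []      q pq≈0 = inj₁ λ _ → ≈-refl
    noZeroDivisors (a ∷ p) q pq≈0 with a ≈? 0#
    ... | no a≉0 = inj₂ (cancelˡ p q a≉0 pq≈0)
    ... | yes a≈0 with noZeroDivisors p q p*q≈0
      where
      p*q≈0 : (p *ᴾ q) ≈ᴾ []
      p*q≈0 k =
        ≈-trans (≈-sym (+-identityˡ _))
        (≈-trans (+-congʳ (≈-sym (≈-trans (*-congʳ a≈0) (zeroˡ _))))
        (≈-trans (≈-sym (coeff-∷* a p q (suc k))) (pq≈0 (suc k))))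
    ...   | inj₁ p≈0 = inj₁ λ { zero → a≈0 ; (suc k) → p≈0 k }
    ...   | inj₂ q≈0 = inj₂ q≈0

  record RationalFunction : Set (c ⊔ ℓ₁) where
    constructor _/_[_]
    field
      num   : Polynomial
      den   : Polynomial
      den≉0 : ¬ (den ≈ᴾ [])

  open RationalFunction public

  polynomial : Polynomial → RationalFunction
  polynomial p = p / constᴾ 1# [ (λ 1≈0 → 1≉0 (1≈0 zero)) ]

  infix 4 _≈ᴿ_
  _≈ᴿ_ : Rel RationalFunction ℓ₁
  f ≈ᴿ g = num f *ᴾ den g ≈ᴾ num g *ᴾ den f

  *-den≉0 : ∀ f g → ¬ (den f *ᴾ den g ≈ᴾ [])
  *-den≉0 f g eq = [ den≉0 f , den≉0 g ]′ (noZeroDivisors (den f) (den g) eq)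

  rationalFunctionField : RawRing (c ⊔ ℓ₁) ℓ₁
  rationalFunctionField = record
    { Carrier = RationalFunction
    ; _≈_     = _≈ᴿ_
    ; _+_     = λ f g → (num f *ᴾ den g +ᴾ num g *ᴾ den f) / den f *ᴾ den g [ *-den≉0 f g ]
    ; _*_     = λ f g → (num f *ᴾ num g) / den f *ᴾ den g [ *-den≉0 f g ]
    ; -_      = λ f → map -_ (num f) / den f [ den≉0 f ]
    ; 0#      = polynomial []
    ; 1#      = polynomial (constᴾ 1#)
    }

  -- f is defined at x with value y. Poles are judged on the reduced
  -- fraction, so any representative of f whose denominator does not
  -- vanish at x may be used.
  _⟨_⟩↦_ : RationalFunction → Carrier → Carrier → Set (c ⊔ ℓ₁)
  f ⟨ x ⟩↦ y = ∃ λ g → g ≈ᴿ f × eval (den g) x ≉ 0# × eval (num g) x ≈ y * eval (den g) x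

  ----------------------------------------------------------------------
  -- Eigenvalues, characteristic polynomial and coronal of a matrix

  IsEigenvalue : ∀ {n} → Matrix n n → Carrier → Set (c ⊔ ℓ₁)
  IsEigenvalue A x =
    ∃ λ v → ¬ (∀ i → v i ≈ 0#) × (∀ i → (A *ⱽ v) i ≈ x * v i)

  module _ where
    private
      module Mᴾ = Matrices polynomialRing
      module Rᴾ = RawRing polynomialRing
      module Mᴿ = Matrices rationalFunctionField
    open RawSemiringDefinitions Rᴾ.rawSemiring using (product)

    -- x I - A
    characteristicMatrix : ∀ {n} → Matrix n n → Mᴾ.Matrix n n
    characteristicMatrix A = Mᴾ.diagonal (λ _ → Xᴾ) Mᴾ.-ᴹ λ i j → constᴾ (A i j)

    -- μ lists the eigenvalues of A with algebraic multiplicity: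
    -- det (x I - A) = ∏ᵢ (x - μ i).
    IsSpectrum : ∀ {n} → Matrix n n → (Fin n → Carrier) → Set ℓ₁
    IsSpectrum A μ =
      Mᴾ.det (characteristicMatrix A) ≈ᴾ product λ i → Xᴾ +ᴾ constᴾ (- μ i)

    -- χ = 𝟏ᵀ (x I - A)⁻¹ 𝟏, the inverse being taken over the field of
    -- rational functions.
    IsCoronal : ∀ {n} → Matrix n n → RationalFunction → Set (c ⊔ ℓ₁)
    IsCoronal A χ = ∃ λ B →
      xI-A Mᴿ.*ᴹ B Mᴿ.≈ᴹ Mᴿ.identity ×
      B Mᴿ.*ᴹ xI-A Mᴿ.≈ᴹ Mᴿ.identity ×
      χ ≈ᴿ Mᴿ.entrySum B
      where
      xI-A : Mᴿ.Matrix _ _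
      xI-A i j = polynomial (characteristicMatrix A i j)

  ----------------------------------------------------------------------
  -- The Laplacian matrix

  adjacencyMatrix : ∀ {n} → Graph n → Matrix n n
  adjacencyMatrix G i j = if does (Graph.adjacent? G i j) then 1# else 0#

  laplacian : ∀ {n} → Graph n → Matrix n n
  laplacian G = diagonal (fromℕ ∘ degree G) -ᴹ adjacencyMatrix G

  LaplacianIntegral : ∀ {n} → Graph n → Set (c ⊔ ℓ₁)
  LaplacianIntegral G = ∀ x → IsEigenvalue (laplacian G) x → IsInteger x

  IsLaplacianSpectrum : ∀ {n} → Graph n → (Fin n → Carrier) → Set ℓ₁
  IsLaplacianSpectrum G = IsSpectrum (laplacian G)

  IsLaplacianCoronal : ∀ {n} → Graph n → RationalFunction → Set (c ⊔ ℓ₁)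
  IsLaplacianCoronal G = IsCoronal (laplacian G)

{-# OPTIONS --safe #-}

-- The rows of L(G₂) sum to 0, so χ(x) = n₂ / x: the roots in question are the x with
-- t² − n₂ μᵢ t − n₂² = 0, where t = x − n₂.
--
-- Let f be a function on the vertices of G₁ ⊛ G₂ and let A i and B i be its sums over
-- the a's and the b's with first index i. For an eigenvector f of eigenvalue x, summing
-- the eigenvalue equations gives
--   n₂ L(G₁) A + n₂ A − n₂ B = x A   and   n₂ B − n₂ A = x B.
-- If A ≠ 0 and x ≠ n₂, eliminating B makes A an eigenvector of L(G₁) whose eigenvalue
-- μᵢ has x as a root of its equation. If A = 0, either some row of the b's is an
-- eigenvector of L(G₂) of eigenvalue x − n₂, or f lives on the a's and x is a degree.
-- Conversely, eigenvectors of L(G₂) orthogonal to 𝟏, and eigenvectors u of L(G₁) with a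
-- root x, extended by −χ(x − n₂) u on the b's, lift to G₁ ⊛ G₂.
module Submission where

open import Defs
open import Algebra.Bundles using (RawRing)
import Algebra.Definitions.RawSemiring as RawSemiringDefinitions
import Algebra.Properties.AbelianGroup as AbelianGroupProperties
import Algebra.Properties.Ring as RingProperties
import Algebra.Properties.Semiring.Mult as Mult
import Algebra.Properties.Semiring.Sum as Sum
import Algebra.Solver.Ring as RingSolver
open import Algebra.Solver.Ring.AlmostCommutativeRing
  using (fromCommutativeRing; _-Raw-AlmostCommutative⟶_)
open import Data.Bool.Base using (true; false; if_then_else_)
open import Data.Fin.Base
  using (Fin; zero; suc; toℕ; inject₁; punchIn; punchOut; _↑ˡ_; _↑ʳ_; join; splitAt; remQuot; combine)
open import Data.Fin.Induction using (<-weakInduction)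
open import Data.Fin.Properties
  using ( _≟_; any?; ¬∀⟶∃¬; toℕ-inject₁; punchIn-punchOut; punchIn-injective; punchInᵢ≢i
        ; splitAt-join; join-splitAt; remQuot-combine; combine-remQuot)
open import Data.Integer.Base as ℤ using (ℤ; +_; -[1+_]; _⊖_)
import Data.Integer.Properties as ℤ
open import Data.List.Base using ([]; _∷_; map; length)
import Data.Maybe.Base as Maybe
open import Data.Nat.Base as ℕ using (ℕ; zero; suc; NonZero)
import Data.Nat.Properties as ℕ
open import Data.Product.Base using (∃; ∃₂; _×_; _,_; proj₁; proj₂; uncurry)
open import Data.Sum.Base using (_⊎_; inj₁; inj₂; [_,_]′)
open import Data.Vec.Base using (count; tabulate)
open import Data.Vec.Functional using (insertAt; removeAt)
open import Data.Vec.Functional.Properties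
  using (insertAt-lookup; insertAt-punchIn; insertAt-removeAt)
open import Function.Base using (_∘_; id)
open import Function.Bundles using (_⇔_; mk⇔)
open import Relation.Binary.Consequences using (dec⇒weaklyDec)
open import Relation.Binary.PropositionalEquality.Core as ≡ using (_≡_; _≢_; refl)
import Relation.Binary.Reasoning.Setoid as SetoidReasoning
open import Relation.Binary.Structures using (IsStrictTotalOrder)
open import Relation.Nullary.Decidable using (does-⇔)
open import Relation.Nullary.Decidable.Core using (yes; no; does; ¬?; decidable-stable)
open import Relation.Nullary.Negation.Core using (¬_; contradiction)

-- The hypotheses speak of polynomials and fractions, the argument of eigenvectors; most of the work
-- lies in passing between the two. The spectrum of L(G₁) is a factorization of det (x I - L(G₁)).
-- Evaluated at a point it becomes a statement over the field, and it yields eigenvectors once det A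
-- = 0 is known to be equivalent to A having a nonzero kernel vector. The expansion along the first
-- row gives column properties by direct induction; the one row property used, that a repeated row
-- makes det vanish, is derived from them through kernel vectors. The coronal may take its value at
-- a point from any representative, and a given representative may have a vanishing denominator
-- there. So x χ(x) = n₂ is obtained as an identity of polynomials, using that the field is infinite
-- and that polynomials have no zero divisors, and is evaluated only afterwards. Since n₂ ≠ 0, χ
-- then has no value at 0: no root has x = n₂, and an eigenvalue n₂ is settled by being an integer.

module Arithmetic {c ℓ₁ ℓ₂} (K : RealClosedField c ℓ₁ ℓ₂) where
  open RealClosedField K
  open Spectral K
  open RingProperties ring
    using (-‿distribˡ-*; -‿distribʳ-*; -‿involutive; -0#≈0#; -‿+-comm)
  open AbelianGroupProperties +-abelianGroup using (xyx⁻¹≈y)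
  open Mult semiring using (×-homo-+; ×1-homo-*)
  open Sum semiring
  open SetoidReasoning setoid

  -- The integers inside the field, cancellation, and finite sums.

  fromℕ-+ : ∀ m n → fromℕ (m ℕ.+ n) ≈ fromℕ m + fromℕ n
  fromℕ-+ = ×-homo-+ 1#

  fromℕ-* : ∀ m n → fromℕ (m ℕ.* n) ≈ fromℕ m * fromℕ n
  fromℕ-* = ×1-homo-*

  fromℤ-neg : ∀ i → fromℤ (ℤ.- i) ≈ - fromℤ i
  fromℤ-neg (+ zero)  = ≈-sym -0#≈0#
  fromℤ-neg (+ suc n) = ≈-refl
  fromℤ-neg -[1+ n ]  = ≈-sym (-‿involutive _)

  fromℤ-⊖ : ∀ m n → fromℤ (m ⊖ n) ≈ fromℕ m + - fromℕ n
  fromℤ-⊖ zero    zero    = ≈-sym (-‿inverseʳ 0#)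
  fromℤ-⊖ zero    (suc n) = ≈-sym (+-identityˡ _)
  fromℤ-⊖ (suc m) zero    = ≈-sym (≈-trans (+-congˡ -0#≈0#) (+-identityʳ _))
  fromℤ-⊖ (suc m) (suc n) = begin
    fromℤ (suc m ⊖ suc n)                     ≡⟨ ≡.cong fromℤ (ℤ.[1+m]⊖[1+n]≡m⊖n m n) ⟩
    fromℤ (m ⊖ n)                             ≈⟨ fromℤ-⊖ m n ⟩
    fromℕ m + - fromℕ n                       ≈⟨ +-congʳ (xyx⁻¹≈y 1# (fromℕ m)) ⟨
    (1# + fromℕ m) - 1# + - fromℕ n           ≈⟨ +-assoc _ _ _ ⟩
    (1# + fromℕ m) + (- 1# + - fromℕ n)       ≈⟨ +-congˡ (-‿+-comm 1# (fromℕ n)) ⟩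
    (1# + fromℕ m) + - (1# + fromℕ n)         ∎

  fromℤ-+ : ∀ i j → fromℤ (i ℤ.+ j) ≈ fromℤ i + fromℤ j
  fromℤ-+ (+ m)    (+ n)    = fromℕ-+ m n
  fromℤ-+ (+ m)    -[1+ n ] = fromℤ-⊖ m (suc n)
  fromℤ-+ -[1+ m ] (+ n)    = ≈-trans (fromℤ-⊖ n (suc m)) (+-comm _ _)
  fromℤ-+ -[1+ m ] -[1+ n ] = begin
    - (1# + (1# + fromℕ (m ℕ.+ n)))           ≈⟨ -‿cong (+-congˡ (+-congˡ (fromℕ-+ m n))) ⟩
    - (1# + (1# + (fromℕ m + fromℕ n)))       ≈⟨ -‿cong (+-congˡ (≈-trans (≈-sym (+-assoc _ _ _)) (≈-trans (+-congʳ (+-comm _ _)) (+-assoc _ _ _)))) ⟩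
    - (1# + (fromℕ m + (1# + fromℕ n)))       ≈⟨ -‿cong (+-assoc _ _ _) ⟨
    - (fromℕ (suc m) + fromℕ (suc n))         ≈⟨ -‿+-comm _ _ ⟨
    - fromℕ (suc m) + - fromℕ (suc n)         ∎

  fromℤ-*-+ : ∀ m j → fromℤ (+ m ℤ.* j) ≈ fromℕ m * fromℤ j
  fromℤ-*-+ m (+ n)    = ≈-trans (reflexive (≡.cong fromℤ (≡.sym (ℤ.pos-* m n)))) (fromℕ-* m n)
  fromℤ-*-+ m -[1+ n ] = begin
    fromℤ (+ m ℤ.* -[1+ n ])                  ≡⟨ ≡.cong fromℤ (ℤ.neg-distribʳ-* (+ m) (+ suc n)) ⟨
    fromℤ (ℤ.- (+ m ℤ.* + suc n))             ≈⟨ fromℤ-neg (+ m ℤ.* + suc n) ⟩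
    - fromℤ (+ m ℤ.* + suc n)                 ≈⟨ -‿cong (fromℤ-*-+ m (+ suc n)) ⟩
    - (fromℕ m * fromℕ (suc n))               ≈⟨ -‿distribʳ-* _ _ ⟩
    fromℕ m * - fromℕ (suc n)                 ∎

  fromℤ-* : ∀ i j → fromℤ (i ℤ.* j) ≈ fromℤ i * fromℤ j
  fromℤ-* (+ m)    j = fromℤ-*-+ m j
  fromℤ-* -[1+ m ] j = begin
    fromℤ (-[1+ m ] ℤ.* j)                    ≡⟨ ≡.cong fromℤ (ℤ.neg-distribˡ-* (+ suc m) j) ⟨
    fromℤ (ℤ.- (+ suc m ℤ.* j))               ≈⟨ fromℤ-neg (+ suc m ℤ.* j) ⟩
    - fromℤ (+ suc m ℤ.* j)                   ≈⟨ -‿cong (fromℤ-*-+ (suc m) j) ⟩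
    - (fromℕ (suc m) * fromℤ j)               ≈⟨ -‿distribˡ-* _ _ ⟩
    - fromℕ (suc m) * fromℤ j                 ∎

  -- Makes ℤ the coefficient ring of the solver below, so that constants compute and opposite terms
  -- cancel.
  fromℤ-homomorphism :
    ℤ.+-*-rawRing -Raw-AlmostCommutative⟶ fromCommutativeRing commutativeRing
  fromℤ-homomorphism = record
    { ⟦_⟧    = fromℤ
    ; +-homo = fromℤ-+
    ; *-homo = fromℤ-*
    ; -‿homo = fromℤ-neg
    ; 0-homo = ≈-refl
    ; 1-homo = +-identityʳ 1#
    }

  module Solver = RingSolver
    ℤ.+-*-rawRing (fromCommutativeRing commutativeRing) fromℤ-homomorphism
    (λ i j → Maybe.map (reflexive ∘ ≡.cong fromℤ) (dec⇒weaklyDec ℤ._≟_ i j))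

  IsInteger-resp-≈ : ∀ {x y} → x ≈ y → IsInteger x → IsInteger y
  IsInteger-resp-≈ x≈y (i , x≈i) = i , ≈-trans (≈-sym x≈y) x≈i

  IsInteger-fromℕ : ∀ n → IsInteger (fromℕ n)
  IsInteger-fromℕ n = + n , ≈-refl

  IsInteger-+ : ∀ {x y} → IsInteger x → IsInteger y → IsInteger (x + y)
  IsInteger-+ (i , x≈i) (j , y≈j) =
    i ℤ.+ j , ≈-trans (+-cong x≈i y≈j) (≈-sym (fromℤ-+ i j))

  IsInteger-neg : ∀ {x} → IsInteger x → IsInteger (- x)
  IsInteger-neg (i , x≈i) = ℤ.- i , ≈-trans (-‿cong x≈i) (≈-sym (fromℤ-neg i))

  x-y≈0⇒x≈y : ∀ {x y} → x - y ≈ 0# → x ≈ y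
  x-y≈0⇒x≈y {x} {y} = AbelianGroupProperties.x∙y⁻¹≈ε⇒x≈y +-abelianGroup x y

  x≈y⇒x-y≈0 : ∀ {x y} → x ≈ y → x - y ≈ 0#
  x≈y⇒x-y≈0 {x} {y} = AbelianGroupProperties.x≈y⇒x∙y⁻¹≈ε +-abelianGroup

  *-cancelˡ-0 : ∀ {x y} → x ≉ 0# → x * y ≈ 0# → y ≈ 0#
  *-cancelˡ-0 {x} {y} x≉0 xy≈0 with inverse x x≉0
  ... | x⁻¹ , xx⁻¹≈1 = begin
    y                ≈⟨ *-identityˡ y ⟨
    1# * y           ≈⟨ *-congʳ xx⁻¹≈1 ⟨
    x * x⁻¹ * y      ≈⟨ solve 3 (λ x z y → x :* z :* y := z :* (x :* y)) ≈-refl x x⁻¹ y ⟩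
    x⁻¹ * (x * y)    ≈⟨ *-congˡ xy≈0 ⟩
    x⁻¹ * 0#         ≈⟨ zeroʳ x⁻¹ ⟩
    0#               ∎
    where open Solver

  *-cancelʳ-0 : ∀ {x y} → y ≉ 0# → x * y ≈ 0# → x ≈ 0#
  *-cancelʳ-0 y≉0 xy≈0 = *-cancelˡ-0 y≉0 (≈-trans (*-comm _ _) xy≈0)

  *-cancelˡ : ∀ {x y z} → x ≉ 0# → x * y ≈ x * z → y ≈ z
  *-cancelˡ {x} {y} {z} x≉0 xy≈xz = x-y≈0⇒x≈y (*-cancelˡ-0 x≉0 (begin
    x * (y - z)      ≈⟨ solve 3 (λ x y z → x :* (y :- z) := x :* y :- x :* z) ≈-refl x y z ⟩
    x * y - x * z    ≈⟨ x≈y⇒x-y≈0 xy≈xz ⟩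
    0#               ∎))
    where open Solver

  *-≉0 : ∀ {x y} → x ≉ 0# → y ≉ 0# → x * y ≉ 0#
  *-≉0 x≉0 y≉0 = y≉0 ∘ *-cancelˡ-0 x≉0

  0<fromℕ : ∀ n → 0# < fromℕ (suc n)
  0<fromℕ zero    = <-respʳ-≈ (≈-sym (+-identityʳ 1#)) 0<1
    where open IsStrictTotalOrder isStrictTotalOrder
  0<fromℕ (suc n) = <-trans (0<fromℕ n) (<-respˡ-≈ (+-identityˡ _) (+-monoˡ-< _ 0<1))
    where open IsStrictTotalOrder isStrictTotalOrder

  -- Characteristic 0, a consequence of the order. It permits division by 2 and by `n₂`, and
  -- supplies infinitely many points of evaluation.
  fromℕ≉0 : ∀ n .{{_ : NonZero n}} → fromℕ n ≉ 0#
  fromℕ≉0 (suc n) n≈0 = irrefl (≈-sym n≈0) (0<fromℕ n)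

  ∑-zero : ∀ {n} {f : Fin n → Carrier} → (∀ i → f i ≈ 0#) → sum f ≈ 0#
  ∑-zero {n} f≈0 = ≈-trans (sum-cong-≋ f≈0) (sum-replicate-zero n)

  ∑-neg : ∀ {n} (f : Fin n → Carrier) → sum (λ i → - f i) ≈ - sum f
  ∑-neg {zero}  f = ≈-sym -0#≈0#
  ∑-neg {suc n} f = ≈-trans (+-congˡ (∑-neg (f ∘ suc))) (-‿+-comm _ _)

  ∑-constant : ∀ n x → ∑[ i < n ] x ≈ fromℕ n * x
  ∑-constant zero    x = ≈-sym (zeroˡ x)
  ∑-constant (suc n) x = ≈-trans (+-cong (≈-sym (*-identityˡ x)) (∑-constant n x)) (≈-sym (distribʳ x 1# (fromℕ n)))

-- Determinants: linearity and alternation in the columns.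

module Determinant {c ℓ₁ ℓ₂} (K : RealClosedField c ℓ₁ ℓ₂) where
  open RealClosedField K
  open Spectral K
  open Arithmetic K
  open Sum semiring
  open RawSemiringDefinitions (RawRing.rawSemiring rawRing) using (_^_)
  open SetoidReasoning setoid
  open Solver using (solve; _:=_; _:+_; _:*_; _:-_; :-_; con)

  minor : ∀ {n} → Matrix (suc n) (suc n) → Fin (suc n) → Matrix n n
  minor A j i k = A (suc i) (punchIn j k)

  cofactor : ∀ {n} → Matrix (suc n) (suc n) → Fin (suc n) → Carrier
  cofactor A j = (- 1#) ^ toℕ j * det (minor A j)

  det-cong : ∀ {n} (A B : Matrix n n) → A ≈ᴹ B → det A ≈ det B
  det-cong {zero}  A B A≈B = ≈-refl
  det-cong {suc n} A B A≈B = sum-cong-≋ λ j → *-congˡ {(- 1#) ^ toℕ j}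
    (*-cong (A≈B zero j) (det-cong (minor A j) (minor B j) λ i k → A≈B (suc i) (punchIn j k)))

  -- In the expansion, the term of column `c` is linear in its entry and its minor avoids `c`; every
  -- other term is linear in its minor by induction, with `c` now at position `punchOut j≢c`.
  det-linear : ∀ {n} (A B C : Matrix n n) x y c →
    (∀ i j → j ≢ c → B i j ≈ A i j) → (∀ i j → j ≢ c → C i j ≈ A i j) →
    (∀ i → A i c ≈ x * B i c + y * C i c) →
    det A ≈ x * det B + y * det C
  det-linear {suc n} A B C x y c B≈A C≈A A≈xB+yC = begin
    ∑[ j < suc n ] term A j
      ≈⟨ sum-cong-≋ step ⟩
    ∑[ j < suc n ] (x * term B j + y * term C j)
      ≈⟨ ∑-distrib-+ (λ j → x * term B j) (λ j → y * term C j) ⟩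
    ∑[ j < suc n ] (x * term B j) + ∑[ j < suc n ] (y * term C j)
      ≈⟨ +-cong (*-distribˡ-sum x (term B)) (*-distribˡ-sum y (term C)) ⟨
    x * det B + y * det C
      ∎
    where
    term : Matrix (suc n) (suc n) → Fin (suc n) → Carrier
    term M j = (- 1#) ^ toℕ j * (M zero j * det (minor M j))

    step : ∀ j → term A j ≈ x * term B j + y * term C j
    step j with j ≟ c
    ... | yes refl = begin
      term A c
        ≈⟨ *-congˡ (*-congʳ (A≈xB+yC zero)) ⟩
      (- 1#) ^ toℕ c * ((x * B zero c + y * C zero c) * det (minor A c))
        ≈⟨ solve 6 (λ s x y b c d → s :* ((x :* b :+ y :* c) :* d)
             := x :* (s :* (b :* d)) :+ y :* (s :* (c :* d)))
             ≈-refl _ x y (B zero c) (C zero c) _ ⟩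
      x * ((- 1#) ^ toℕ c * (B zero c * det (minor A c))) +
      y * ((- 1#) ^ toℕ c * (C zero c * det (minor A c)))
        ≈⟨ +-cong (*-congˡ (*-congˡ (*-congˡ (det-cong _ _ λ i k → ≈-sym (B≈A (suc i) _ (punchInᵢ≢i c k))))))
                  (*-congˡ (*-congˡ (*-congˡ (det-cong _ _ λ i k → ≈-sym (C≈A (suc i) _ (punchInᵢ≢i c k)))))) ⟩
      x * term B c + y * term C c
        ∎
    ... | no j≢c = begin
      term A j
        ≈⟨ *-congˡ (*-congˡ (det-linear (minor A j) (minor B j) (minor C j) x y (punchOut j≢c)
             (λ i k k≢ → B≈A (suc i) _ (k≢ ∘ unpunch))
             (λ i k k≢ → C≈A (suc i) _ (k≢ ∘ unpunch))
             combination)) ⟩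
      (- 1#) ^ toℕ j * (A zero j * (x * det (minor B j) + y * det (minor C j)))
        ≈⟨ solve 6 (λ s a x y b c → s :* (a :* (x :* b :+ y :* c))
             := x :* (s :* (a :* b)) :+ y :* (s :* (a :* c)))
             ≈-refl _ (A zero j) x y _ _ ⟩
      x * ((- 1#) ^ toℕ j * (A zero j * det (minor B j))) +
      y * ((- 1#) ^ toℕ j * (A zero j * det (minor C j)))
        ≈⟨ +-cong (*-congˡ (*-congˡ (*-congʳ (≈-sym (B≈A zero j j≢c)))))
                  (*-congˡ (*-congˡ (*-congʳ (≈-sym (C≈A zero j j≢c))))) ⟩
      x * term B j + y * term C j
        ∎
      where
      unpunch : ∀ {k} → punchIn j k ≡ c → k ≡ punchOut j≢c
      unpunch eq = punchIn-injective j _ _ (≡.trans eq (≡.sym (punchIn-punchOut j≢c)))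

      combination : ∀ i → minor A j i (punchOut j≢c) ≈
        x * minor B j i (punchOut j≢c) + y * minor C j i (punchOut j≢c)
      combination i rewrite punchIn-punchOut j≢c = A≈xB+yC (suc i)


  -- Deleting column j keeps the columns k and k + 1 adjacent, as k′ and k′ + 1.
  data Away : ∀ {n} → Fin (suc n) → Fin n → Set where
    away : ∀ {n} {j : Fin (suc (suc n))} {k : Fin (suc n)} (k′ : Fin n) →
           punchIn j (inject₁ k′) ≡ inject₁ k → punchIn j (suc k′) ≡ suc k → Away j k

  -- The pattern of cancellation in `det-swap`: the terms of the two swapped columns cancel each
  -- other, all others vanish one by one. `Away` hands each of these the new position of the swapped
  -- pair in its minor.
  ∑-cancel-adjacent : ∀ {n} (f : Fin (suc n) → Carrier) (k : Fin n) →
    f (inject₁ k) + f (suc k) ≈ 0# → (∀ j → Away j k → f j ≈ 0#) → sum f ≈ 0#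
  ∑-cancel-adjacent {suc n} f zero pair rest = begin
    f zero + (f (suc zero) + sum f″)   ≈⟨ +-assoc _ _ _ ⟨
    f zero + f (suc zero) + sum f″     ≈⟨ +-cong pair (∑-zero (away-zero f rest)) ⟩
    0# + 0#                                         ≈⟨ +-identityˡ 0# ⟩
    0#                                              ∎
    where
    f″ : Fin n → Carrier
    f″ j = f (suc (suc j))
    away-zero : ∀ {n} (f : Fin (suc (suc n)) → Carrier) →
      (∀ j → Away j zero → f j ≈ 0#) → ∀ j → f (suc (suc j)) ≈ 0#
    away-zero {suc n} f rest j = rest (suc (suc j)) (away zero refl refl)
  ∑-cancel-adjacent {suc (suc n)} f (suc k) pair rest = begin
    f zero + sum (f ∘ suc)   ≈⟨ +-cong (rest zero (away k refl refl))
                                  (∑-cancel-adjacent (f ∘ suc) k pair rest′) ⟩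
    0# + 0#                  ≈⟨ +-identityˡ 0# ⟩
    0#                       ∎
    where
    rest′ : ∀ j → Away j k → f (suc j) ≈ 0#
    rest′ j (away k′ eq₁ eq₂) =
      rest (suc j) (away (suc k′) (≡.cong suc eq₁) (≡.cong suc eq₂))

  -- Deleting column k and deleting column k + 1 leave the same columns, except in the one place
  -- where the former keeps k + 1 and the latter k. This matches the two exchanged minors in
  -- `det-swap`.
  punchIn-adjacent : ∀ {n} (k l : Fin n) →
    punchIn (inject₁ k) l ≡ punchIn (suc k) l ⊎
    (punchIn (inject₁ k) l ≡ suc k × punchIn (suc k) l ≡ inject₁ k)
  punchIn-adjacent zero    zero    = inj₂ (refl , refl)
  punchIn-adjacent zero    (suc l) = inj₁ refl
  punchIn-adjacent (suc k) zero    = inj₁ refl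
  punchIn-adjacent (suc k) (suc l) with punchIn-adjacent k l
  ... | inj₁ eq          = inj₁ (≡.cong suc eq)
  ... | inj₂ (eq₁ , eq₂) = inj₂ (≡.cong suc eq₁ , ≡.cong suc eq₂)

  -- A relation between two matrices, so that it passes to minors and also holds between a matrix
  -- and itself when the two columns agree.
  record Swapped {m n} (A B : Matrix m (suc n)) (k : Fin n) : Set ℓ₁ where
    field
      first  : ∀ i → A i (inject₁ k) ≈ B i (suc k)
      second : ∀ i → A i (suc k) ≈ B i (inject₁ k)
      others : ∀ i j → j ≢ inject₁ k → j ≢ suc k → A i j ≈ B i j

  -- Away from the pair, the minors are again swapped and cancel by induction. At the pair, the
  -- minors are exchanged and the signs of positions k and k + 1 are opposite.
  det-swap : ∀ {n} {A B : Matrix (suc n) (suc n)} {k} → Swapped A B k →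
             det A + det B ≈ 0#
  det-swap {suc n} {A} {B} {k} swapped = begin
    det A + det B
      ≈⟨ ∑-distrib-+ (term A) (term B) ⟨
    ∑[ j < suc (suc n) ] (term A j + term B j)
      ≈⟨ ∑-cancel-adjacent (λ j → term A j + term B j) k pair rest ⟩
    0#
      ∎
    where
    open Swapped swapped
    term : Matrix (suc (suc n)) (suc (suc n)) → Fin (suc (suc n)) → Carrier
    term M j = (- 1#) ^ toℕ j * (M zero j * det (minor M j))

    minor₁ : minor A (inject₁ k) ≈ᴹ minor B (suc k)
    minor₁ i l with punchIn-adjacent k l | punchInᵢ≢i (inject₁ k) l | punchInᵢ≢i (suc k) l
    ... | inj₁ eq          | ≢₁ | ≢₂ rewrite eq = others (suc i) _ ≢₁ ≢₂
    ... | inj₂ (eq₁ , eq₂) | _  | _  rewrite eq₁ | eq₂ = second (suc i)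

    minor₂ : minor A (suc k) ≈ᴹ minor B (inject₁ k)
    minor₂ i l with punchIn-adjacent k l | punchInᵢ≢i (inject₁ k) l | punchInᵢ≢i (suc k) l
    ... | inj₁ eq          | ≢₁ | ≢₂ rewrite eq = others (suc i) _ ≢₁ ≢₂
    ... | inj₂ (eq₁ , eq₂) | _  | _  rewrite eq₁ | eq₂ = first (suc i)

    pair : (term A (inject₁ k) + term B (inject₁ k)) + (term A (suc k) + term B (suc k)) ≈ 0#
    pair = begin
      (term A (inject₁ k) + term B (inject₁ k)) + (term A (suc k) + term B (suc k))
        ≈⟨ +-cong (+-cong
             (*-cong (reflexive (≡.cong ((- 1#) ^_) (toℕ-inject₁ k)))
                     (*-cong (first zero) (det-cong _ _ minor₁)))
             (*-congʳ (reflexive (≡.cong ((- 1#) ^_) (toℕ-inject₁ k)))))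
           (+-congʳ (*-congˡ (*-cong (second zero) (det-cong _ _ minor₂)))) ⟩
      (s * x + s * y) + (((- 1#) * s) * y + ((- 1#) * s) * x)
        -- `1#` enters as the variable `o`, since the solver constant for the integer 1 would denote
        -- `1# + 0#`.
        ≈⟨ solve 4 (λ s x y o → (s :* x :+ s :* y) :+ (((:- o) :* s) :* y :+ ((:- o) :* s) :* x)
             := (s :* x :+ s :* y) :- o :* (s :* x :+ s :* y)) ≈-refl s x y 1# ⟩
      (s * x + s * y) - 1# * (s * x + s * y)
        ≈⟨ x≈y⇒x-y≈0 (≈-sym (*-identityˡ _)) ⟩
      0#
        ∎
      where
      s x y : Carrier
      s = (- 1#) ^ toℕ k
      x = B zero (suc k) * det (minor B (suc k))
      y = B zero (inject₁ k) * det (minor B (inject₁ k))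

    rest : ∀ j → Away j k → term A j + term B j ≈ 0#
    rest j (away k′ eq₁ eq₂) = begin
      s * (A zero j * det (minor A j)) + s * (B zero j * det (minor B j))
        ≈⟨ +-congʳ (*-congˡ (*-congʳ (others zero j
             (λ eq → punchInᵢ≢i j _ (≡.trans eq₁ (≡.sym eq)))
             (λ eq → punchInᵢ≢i j _ (≡.trans eq₂ (≡.sym eq)))))) ⟩
      s * (B zero j * det (minor A j)) + s * (B zero j * det (minor B j))
        ≈⟨ solve 4 (λ s b x y → s :* (b :* x) :+ s :* (b :* y) := s :* b :* (x :+ y))
             ≈-refl s (B zero j) _ _ ⟩
      s * B zero j * (det (minor A j) + det (minor B j))
        ≈⟨ *-congˡ (det-swap record
             { first  = λ i → ≈-trans (reflexive (≡.cong (A (suc i)) eq₁))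
                        (≈-trans (first (suc i)) (reflexive (≡.cong (B (suc i)) (≡.sym eq₂))))
             ; second = λ i → ≈-trans (reflexive (≡.cong (A (suc i)) eq₂))
                        (≈-trans (second (suc i)) (reflexive (≡.cong (B (suc i)) (≡.sym eq₁))))
             ; others = λ i l l≢₁ l≢₂ → others (suc i) (punchIn j l)
                 (λ eq → l≢₁ (punchIn-injective j _ _ (≡.trans eq (≡.sym eq₁))))
                 (λ eq → l≢₂ (punchIn-injective j _ _ (≡.trans eq (≡.sym eq₂))))
             }) ⟩
      s * B zero j * 0#
        ≈⟨ zeroʳ _ ⟩
      0#
        ∎
      where s = (- 1#) ^ toℕ j

  x+x≈0⇒x≈0 : ∀ {x} → x + x ≈ 0# → x ≈ 0#
  x+x≈0⇒x≈0 {x} x+x≈0 = *-cancelˡ-0 (fromℕ≉0 2) (begin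
    fromℕ 2 * x   ≈⟨ ∑-constant 2 x ⟨
    x + (x + 0#)  ≈⟨ +-congˡ (+-identityʳ x) ⟩
    x + x         ≈⟨ x+x≈0 ⟩
    0#            ∎)

  insertColumn : ∀ {m n} → Matrix m n → Fin (suc n) → (Fin m → Carrier) → Matrix m (suc n)
  insertColumn A c v i = insertAt (A i) c (v i)

  -- Moving the inserted entry one place further exchanges it with `v k`: the content of
  -- `insertColumn-swapped` in a single row.
  insertAt-step : ∀ {n} (v : Fin n → Carrier) (k : Fin n) x →
    insertAt v (suc k) x (inject₁ k) ≡ v k ×
    insertAt v (inject₁ k) x (suc k) ≡ v k ×
    (∀ j → j ≢ inject₁ k → j ≢ suc k → insertAt v (suc k) x j ≡ insertAt v (inject₁ k) x j)
  insertAt-step v zero x = refl , refl , λ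
    { zero          ≢₁ ≢₂ → contradiction refl ≢₁
    ; (suc zero)    ≢₁ ≢₂ → contradiction refl ≢₂
    ; (suc (suc j)) ≢₁ ≢₂ → refl }
  insertAt-step v (suc k) x with insertAt-step (v ∘ suc) k x
  ... | eq₁ , eq₂ , eq₃ = eq₁ , eq₂ , λ
    { zero    ≢₁ ≢₂ → refl
    ; (suc j) ≢₁ ≢₂ → eq₃ j (≢₁ ∘ ≡.cong suc) (≢₂ ∘ ≡.cong suc) }

  insertColumn-swapped : ∀ {m n} (A : Matrix m n) v k →
    Swapped (insertColumn A (inject₁ k) v) (insertColumn A (suc k) v) k
  insertColumn-swapped A v k = record
    { first  = λ i → reflexive (≡.trans (insertAt-lookup (A i) (inject₁ k) (v i))
                                (≡.sym (insertAt-lookup (A i) (suc k) (v i))))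
    ; second = λ i → let eq₁ , eq₂ , _ = insertAt-step (A i) k (v i) in
                     reflexive (≡.trans eq₂ (≡.sym eq₁))
    ; others = λ i j ≢₁ ≢₂ → let _ , _ , eq₃ = insertAt-step (A i) k (v i) in
                             reflexive (≡.sym (eq₃ j ≢₁ ≢₂))
    }

  -- Each move of the inserted column by one place changes only the sign of the determinant.
  -- Following whether it vanishes, rather than its value, avoids tracking that sign.
  det-insertColumn-zero : ∀ {n} (A : Matrix (suc n) n) v c →
    (det (insertColumn A c v) ≈ 0# → det (insertColumn A zero v) ≈ 0#) ×
    (det (insertColumn A zero v) ≈ 0# → det (insertColumn A c v) ≈ 0#)
  det-insertColumn-zero {n} A v = <-weakInduction P (id , id) λ k (to , from) →
    let sum≈0 = det-swap (insertColumn-swapped A v k) in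
    (λ eq → to (≈-trans (≈-sym (+-identityʳ _)) (≈-trans (+-congˡ (≈-sym eq)) sum≈0))) ,
    (λ eq → ≈-trans (≈-sym (+-identityˡ _)) (≈-trans (+-congʳ (≈-sym (from eq))) sum≈0))
    where
    P : Fin (suc n) → Set ℓ₁
    P c = (det (insertColumn A c v) ≈ 0# → det (insertColumn A zero v) ≈ 0#) ×
          (det (insertColumn A zero v) ≈ 0# → det (insertColumn A c v) ≈ 0#)

  -- Inserted next to the column it equals, v makes the matrix its own swap.
  det-insertColumn-alternating : ∀ {n} (A : Matrix (suc n) n) v c d →
    (∀ i → A i d ≈ v i) → det (insertColumn A c v) ≈ 0#
  det-insertColumn-alternating A v c d A≈v =
    proj₂ (det-insertColumn-zero A v c)
      (proj₁ (det-insertColumn-zero A v (suc d)) (x+x≈0⇒x≈0 (det-swap {A = A₀} {A₀} {d} record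
        { first  = λ i → ≈-sym (adjacent i)
        ; second = adjacent
        ; others = λ _ _ _ _ → ≈-refl
        })))
    where
    A₀ = insertColumn A (suc d) v
    adjacent : ∀ i → insertColumn A (suc d) v i (suc d) ≈ insertColumn A (suc d) v i (inject₁ d)
    adjacent i = begin
      insertColumn A (suc d) v i (suc d)      ≡⟨ insertAt-lookup (A i) (suc d) (v i) ⟩
      v i                                     ≈⟨ A≈v i ⟨
      A i d                                   ≡⟨ proj₁ (insertAt-step (A i) d (v i)) ⟨
      insertColumn A (suc d) v i (inject₁ d)  ∎

  -- Vanishing determinants and kernel vectors.

  Kernel : ∀ {m n} → Matrix m n → Set _
  Kernel {n = n} A = ∃ λ v → (∃ λ j → v j ≉ 0#) × (∀ i → (A *ⱽ v) i ≈ 0#)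

  insertColumn-others : ∀ {m n} (A : Matrix m n) c v w i j → j ≢ c →
    insertColumn A c v i j ≈ insertColumn A c w i j
  insertColumn-others A c v w i j j≢c = reflexive (agree j j≢c)
    where
    agree : ∀ j → j ≢ c → insertAt (A i) c (v i) j ≡ insertAt (A i) c (w i) j
    agree j j≢c = ≡.subst (λ j → insertAt (A i) c (v i) j ≡ insertAt (A i) c (w i) j)
      (punchIn-punchOut (j≢c ∘ ≡.sym))
      (≡.trans (insertAt-punchIn (A i) c (v i) _) (≡.sym (insertAt-punchIn (A i) c (w i) _)))

  insertColumn-lookup : ∀ {m n} (A : Matrix m n) c v i → insertColumn A c v i c ≈ v i
  insertColumn-lookup A c v i = reflexive (insertAt-lookup (A i) c (v i))

  det-insertColumn-sum : ∀ {m n} (A : Matrix (suc n) n) c (x : Fin m → Carrier)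
    (W : Fin m → Fin (suc n) → Carrier) →
    det (insertColumn A c (λ i → ∑[ k < m ] (x k * W k i))) ≈
    ∑[ k < m ] (x k * det (insertColumn A c (W k)))
  det-insertColumn-sum {zero} A c x W = begin
    -- The empty combination is a zero column, and this equals 0 times itself plus 0 times itself.
    det A₀                       ≈⟨ det-linear A₀ A₀ A₀ 0# 0# c (λ _ _ _ → ≈-refl) (λ _ _ _ → ≈-refl) zero-column ⟩
    0# * det A₀ + 0# * det A₀    ≈⟨ solve 1 (λ x → con (ℤ.+ 0) :* x :+ con (ℤ.+ 0) :* x := con (ℤ.+ 0)) ≈-refl (det A₀) ⟩
    0#                           ∎
    where
    A₀ = insertColumn A c (λ _ → 0#)
    zero-column : ∀ i → A₀ i c ≈ 0# * A₀ i c + 0# * A₀ i c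
    zero-column i = ≈-trans (insertColumn-lookup A c _ i)
      (solve 1 (λ x → con (ℤ.+ 0) := con (ℤ.+ 0) :* x :+ con (ℤ.+ 0) :* x) ≈-refl (A₀ i c))
  det-insertColumn-sum {suc m} A c x W = begin
    det (insertColumn A c (λ i → x zero * W zero i + w i))
      ≈⟨ det-linear (insertColumn A c λ i → x zero * W zero i + w i) (insertColumn A c (W zero)) (insertColumn A c w) (x zero) 1# c
           (insertColumn-others A c (W zero) _) (insertColumn-others A c w _)
           (λ i → ≈-trans (insertColumn-lookup A c (λ i → x zero * W zero i + w i) i) (+-cong
             (*-congˡ (≈-sym (insertColumn-lookup A c (W zero) i)))
             (≈-trans (≈-sym (*-identityˡ _)) (*-congˡ (≈-sym (insertColumn-lookup A c w i)))))) ⟩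
    x zero * det (insertColumn A c (W zero)) + 1# * det (insertColumn A c w)
      ≈⟨ +-congˡ (*-identityˡ _) ⟩
    x zero * det (insertColumn A c (W zero)) + det (insertColumn A c w)
      ≈⟨ +-congˡ (det-insertColumn-sum A c (x ∘ suc) (W ∘ suc)) ⟩
    ∑[ k < suc m ] (x k * det (insertColumn A c (W k)))
      ∎
    where
    w : Fin _ → Carrier
    w i = ∑[ k < m ] (x (suc k) * W (suc k) i)

  -- Cramer's rule: `v c * det A` is the determinant of A with column c replaced by A v, which is 0.
  -- When A v is expanded into columns of A, each column other than c repeats one that is kept in
  -- `B`.
  kernel⇒det≈0 : ∀ {n} (A : Matrix n n) → Kernel A → det A ≈ 0#
  kernel⇒det≈0 {suc n} A (v , (c , vc≉0) , Av≈0) = *-cancelˡ-0 vc≉0 (begin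
    v c * det A
      ≈⟨ *-congˡ (det-cong A (inserted c) λ i j → reflexive (≡.sym (insertAt-removeAt (A i) c j))) ⟩
    v c * det (inserted c)
      ≈⟨ +-identityʳ _ ⟨
    v c * det (inserted c) + 0#
      ≈⟨ +-congˡ (∑-zero λ k → ≈-trans (*-congˡ (det-insertColumn-alternating B _ c k λ _ → ≈-refl)) (zeroʳ _)) ⟨
    v c * det (inserted c) + ∑[ k < n ] (v (punchIn c k) * det (inserted (punchIn c k)))
      ≈⟨ sum-remove {i = c} (λ k → v k * det (inserted k)) ⟨
    ∑[ k < suc n ] (v k * det (inserted k))
      ≈⟨ det-insertColumn-sum B c v (λ k i → A i k) ⟨
    det (insertColumn B c (λ i → ∑[ k < suc n ] (v k * A i k)))
      ≈⟨ det-cong (insertColumn B c _) (insertColumn B c _) (λ i j → insertAt-cong j (λ i → ≈-trans (sum-cong-≋ (λ k → *-comm (v k) (A i k))) (Av≈0 i)) i) ⟩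
    det (insertColumn B c (λ i → 0#))
      -- The zero column read as an empty combination.
      ≈⟨ det-insertColumn-sum {m = 0} B c (λ ()) (λ ()) ⟩
    0# ∎)
    where
    B : Matrix (suc n) n
    B i = removeAt (A i) c
    inserted : Fin (suc n) → Matrix (suc n) (suc n)
    inserted k = insertColumn B c (λ i → A i k)
    insertAt-cong : ∀ {v w : Fin (suc n) → Carrier} j → (∀ i → v i ≈ w i) →
      ∀ i → insertColumn B c v i j ≈ insertColumn B c w i j
    insertAt-cong {v} {w} j v≈w i with j ≟ c
    ... | yes refl = ≈-trans (insertColumn-lookup B c v i) (≈-trans (v≈w i) (≈-sym (insertColumn-lookup B c w i)))
    ... | no j≢c   = insertColumn-others B c v w i j j≢c

  *ⱽ-linear : ∀ {m n} (A : Matrix m n) x y v w i →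
    (A *ⱽ λ j → x * v j + y * w j) i ≈ x * (A *ⱽ v) i + y * (A *ⱽ w) i
  *ⱽ-linear {n = n} A x y v w i = begin
    ∑[ j < n ] (A i j * (x * v j + y * w j))
      ≈⟨ sum-cong-≋ (λ j → solve 5 (λ a x y v w →
           a :* (x :* v :+ y :* w) := x :* (a :* v) :+ y :* (a :* w)) ≈-refl (A i j) x y (v j) (w j)) ⟩
    ∑[ j < n ] (x * (A i j * v j) + y * (A i j * w j))
      ≈⟨ ∑-distrib-+ (λ j → x * (A i j * v j)) (λ j → y * (A i j * w j)) ⟩
    ∑[ j < n ] (x * (A i j * v j)) + ∑[ j < n ] (y * (A i j * w j))
      ≈⟨ +-cong (*-distribˡ-sum x (λ j → A i j * v j)) (*-distribˡ-sum y (λ j → A i j * w j)) ⟨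
    x * (A *ⱽ v) i + y * (A *ⱽ w) i
      ∎

  -- The vector is padded with 0 at the deleted column. That zero is part of the result because
  -- `kernel-tail` draws independence from it.
  kernel-extend : ∀ {m n} (A : Matrix m (suc n)) c → Kernel (λ i → removeAt (A i) c) →
    ∃ λ v → v c ≈ 0# × (∃ λ j → v j ≉ 0#) × (∀ i → (A *ⱽ v) i ≈ 0#)
  kernel-extend {n = n} A c (u , (j , uj≉0) , Bu≈0) =
    v , vc≈0 , (punchIn c j , λ vj≈0 → uj≉0 (≈-trans (≈-sym (v-punchIn j)) vj≈0)) , λ i → begin
      ∑[ k < suc n ] (A i k * v k)
        ≈⟨ sum-remove {i = c} (λ k → A i k * v k) ⟩
      A i c * v c + ∑[ k < n ] (A i (punchIn c k) * v (punchIn c k))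
        ≈⟨ +-cong (≈-trans (*-congˡ vc≈0) (zeroʳ _)) (sum-cong-≋ λ k → *-congˡ (v-punchIn k)) ⟩
      0# + ∑[ k < n ] (A i (punchIn c k) * u k)
        ≈⟨ +-identityˡ _ ⟩
      ∑[ k < n ] (A i (punchIn c k) * u k)
        ≈⟨ Bu≈0 i ⟩
      0# ∎
    where
    v : Fin (suc n) → Carrier
    v = insertAt u c 0#
    vc≈0 : v c ≈ 0#
    vc≈0 = reflexive (insertAt-lookup u c 0#)
    v-punchIn : ∀ k → v (punchIn c k) ≈ u k
    v-punchIn k = reflexive (insertAt-punchIn u c 0# k)

  -- Two kernel vectors of the lower rows, one of which vanishes at a coordinate
  -- where the other does not, are independent, so some combination of them is
  -- also annihilated by the first row.
  kernel-tail : ∀ {m n} (A : Matrix (suc m) (suc (suc n))) →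
    (∀ c → Kernel (λ i → removeAt (A (suc i)) c)) → Kernel A
  kernel-tail {n = n} A kernels
    with kernel-extend (A ∘ suc) zero (kernels zero)
  ... | u , _ , (a , ua≉0) , Au≈0 with (A *ⱽ u) zero ≈? 0#
  ...   | yes ru≈0 = u , (a , ua≉0) , λ { zero → ru≈0 ; (suc i) → Au≈0 i }
  ...   | no ru≉0 with kernel-extend (A ∘ suc) a (kernels a)
  ...     | w , wa≈0 , w≉0 , Aw≈0 with (A *ⱽ w) zero ≈? 0#
  ...       | yes rw≈0 = w , w≉0 , λ { zero → rw≈0 ; (suc i) → Aw≈0 i }
  ...       | no rw≉0 = v , (a , λ va≈0 → *-≉0 rw≉0 ua≉0 (≈-trans (≈-sym va≈rw*ua) va≈0)) , Av≈0
    where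
    ru rw : Carrier
    ru = (A *ⱽ u) zero
    rw = (A *ⱽ w) zero
    v : Fin (suc (suc n)) → Carrier
    v j = rw * u j + (- ru) * w j
    va≈rw*ua : v a ≈ rw * u a
    va≈rw*ua = ≈-trans (+-congˡ (≈-trans (*-congˡ wa≈0) (zeroʳ _))) (+-identityʳ _)
    Av≈0 : ∀ i → (A *ⱽ v) i ≈ 0#
    Av≈0 zero    = ≈-trans (*ⱽ-linear A rw (- ru) u w zero)
      (solve 2 (λ x y → x :* y :+ (:- y) :* x := con (ℤ.+ 0)) ≈-refl rw ru)
    Av≈0 (suc i) = ≈-trans (*ⱽ-linear A rw (- ru) u w (suc i)) (≈-trans
      (+-cong (*-congˡ (Au≈0 i)) (*-congˡ (Aw≈0 i)))
      (≈-trans (+-cong (zeroʳ _) (zeroʳ _)) (+-identityˡ 0#)))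

  -- Deleting the first row and any one column leaves a matrix that again has one column more than
  -- rows, which is what `kernel-tail` asks for.
  wide⇒kernel : ∀ {n} (A : Matrix n (suc n)) → Kernel A
  wide⇒kernel {zero}  A = (λ _ → 1#) , (zero , 1≉0) , λ ()
  wide⇒kernel {suc n} A = kernel-tail A λ c → wide⇒kernel (λ i → removeAt (A (suc i)) c)

  ±x≈0⇒x≈0 : ∀ k {x} → (- 1#) ^ k * x ≈ 0# → x ≈ 0#
  ±x≈0⇒x≈0 zero    eq = ≈-trans (≈-sym (*-identityˡ _)) eq
  ±x≈0⇒x≈0 (suc k) eq = ±x≈0⇒x≈0 k (*-cancelˡ-0 -1≉0 (≈-trans (≈-sym (*-assoc _ _ _)) eq))
    where
    -1≉0 : - 1# ≉ 0#
    -1≉0 -1≈0 = 1≉0 (≈-trans (≈-sym (+-identityʳ 1#)) (≈-trans (+-congˡ (≈-sym -1≈0)) (-‿inverseʳ 1#)))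

  replaceFirstRow : ∀ {m n} → Matrix (suc m) n → (Fin n → Carrier) → Matrix (suc m) n
  replaceFirstRow A v zero    = v
  replaceFirstRow A v (suc i) = A (suc i)

  -- Replacing the first row leaves all minors of the expansion unchanged. The first row itself
  -- gives det A, any other row a matrix with a repeated row.
  *ⱽ-cofactor : ∀ {n} (A : Matrix (suc n) (suc n)) i →
    (A *ⱽ cofactor A) i ≈ det (replaceFirstRow A (A i))
  *ⱽ-cofactor A i = sum-cong-≋ λ j →
    solve 3 (λ a s d → a :* (s :* d) := s :* (a :* d)) ≈-refl
      (A i j) ((- 1#) ^ toℕ j) (det (minor A j))

  -- If some cofactor of the first row is nonzero, the cofactors form a kernel vector;
  -- otherwise all minors are singular, and kernel-tail applies.
  det≈0⇒kernel : ∀ {n} (A : Matrix n n) → det A ≈ 0# → Kernel A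
  det≈0⇒kernel {zero}  A det≈0 = contradiction det≈0 1≉0
  det≈0⇒kernel {suc n} A det≈0 with any? (λ j → ¬? (cofactor A j ≈? 0#))
  ... | yes cofactor≉0 = cofactor A , cofactor≉0 , λ
    { zero    → ≈-trans (*ⱽ-cofactor A zero) det≈0
    ; (suc i) → ≈-trans (*ⱽ-cofactor A (suc i)) (repeated-row i)
    }
    where
    -- Alternation in the rows, derived from columns: the rows below the first form a wide matrix
    -- and have a kernel vector; the new first row copies one of them, so the vector kills the whole
    -- matrix.
    repeated-row : ∀ i → det (replaceFirstRow A (A (suc i))) ≈ 0#
    repeated-row i with wide⇒kernel (A ∘ suc)
    ... | v , v≉0 , Av≈0 = kernel⇒det≈0 (replaceFirstRow A (A (suc i))) (v , v≉0 , λ { zero → Av≈0 i ; (suc k) → Av≈0 k })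
  ... | no ∄cofactor≉0 = kernel n A minor≈0
    where
    minor≈0 : ∀ j → det (minor A j) ≈ 0#
    minor≈0 j = ±x≈0⇒x≈0 (toℕ j) (decidable-stable (_ ≈? 0#) λ ≉0 → ∄cofactor≉0 (j , ≉0))
    kernel : ∀ n (A : Matrix (suc n) (suc n)) → (∀ j → det (minor A j) ≈ 0#) → Kernel A
    kernel zero    A minor≈0 = contradiction (minor≈0 zero) 1≉0
    kernel (suc n) A minor≈0 = kernel-tail A λ c → det≈0⇒kernel (minor A c) (minor≈0 c)

-- Polynomials as functions on the field.

module Evaluation {c ℓ₁ ℓ₂} (K : RealClosedField c ℓ₁ ℓ₂) where
  open RealClosedField K
  open Spectral K
  open Arithmetic K
  open Determinant K
  open RingProperties ring using (-0#≈0#)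
  open Sum semiring
  open SetoidReasoning setoid
  open Solver using (solve; _:=_; _:+_; _:*_; _:-_; :-_; con)
  private
    module Kᴹ = RawSemiringDefinitions (RawRing.rawSemiring rawRing)
    module Pᴹ = RawSemiringDefinitions (RawRing.rawSemiring polynomialRing)
    module Mᴾ = Matrices polynomialRing

  eval-≈[] : ∀ p x → p ≈ᴾ [] → eval p x ≈ 0#
  eval-≈[] []      x p≈0 = ≈-refl
  eval-≈[] (a ∷ p) x p≈0 = begin
    a + x * eval p x   ≈⟨ +-cong (p≈0 zero) (*-congˡ (eval-≈[] p x (p≈0 ∘ suc))) ⟩
    0# + x * 0#        ≈⟨ +-identityˡ _ ⟩
    x * 0#             ≈⟨ zeroʳ x ⟩
    0#                 ∎

  eval-cong : ∀ p q x → p ≈ᴾ q → eval p x ≈ eval q x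
  eval-cong []      q       x p≈q = ≈-sym (eval-≈[] q x (≈-sym ∘ p≈q))
  eval-cong (a ∷ p) []      x p≈q = eval-≈[] (a ∷ p) x p≈q
  eval-cong (a ∷ p) (b ∷ q) x p≈q = +-cong (p≈q zero) (*-congˡ (eval-cong p q x (p≈q ∘ suc)))

  eval-+ : ∀ p q x → eval (p +ᴾ q) x ≈ eval p x + eval q x
  eval-+ []      q       x = ≈-sym (+-identityˡ _)
  eval-+ (a ∷ p) []      x = ≈-sym (+-identityʳ _)
  eval-+ (a ∷ p) (b ∷ q) x = ≈-trans (+-congˡ (*-congˡ (eval-+ p q x)))
    (solve 5 (λ a b x p q → a :+ b :+ x :* (p :+ q) := a :+ x :* p :+ (b :+ x :* q))
      ≈-refl a b x (eval p x) (eval q x))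

  eval-scale : ∀ a p x → eval (map (a *_) p) x ≈ a * eval p x
  eval-scale a []      x = ≈-sym (zeroʳ a)
  eval-scale a (b ∷ p) x = ≈-trans (+-congˡ (*-congˡ (eval-scale a p x)))
    (solve 4 (λ a b x p → a :* b :+ x :* (a :* p) := a :* (b :+ x :* p)) ≈-refl a b x (eval p x))

  eval-* : ∀ p q x → eval (p *ᴾ q) x ≈ eval p x * eval q x
  eval-* []      q x = ≈-sym (zeroˡ _)
  eval-* (a ∷ p) q x = begin
    eval (map (a *_) q +ᴾ (0# ∷ p *ᴾ q)) x
      ≈⟨ eval-+ (map (a *_) q) (0# ∷ p *ᴾ q) x ⟩
    eval (map (a *_) q) x + (0# + x * eval (p *ᴾ q) x)
      ≈⟨ +-cong (eval-scale a q x) (+-congˡ (*-congˡ (eval-* p q x))) ⟩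
    a * eval q x + (0# + x * (eval p x * eval q x))
      ≈⟨ solve 4 (λ a x p q → a :* q :+ (con (ℤ.+ 0) :+ x :* (p :* q)) := (a :+ x :* p) :* q)
           ≈-refl a x (eval p x) (eval q x) ⟩
    (a + x * eval p x) * eval q x
      ∎

  eval-neg : ∀ p x → eval (map -_ p) x ≈ - eval p x
  eval-neg []      x = ≈-sym -0#≈0#
  eval-neg (a ∷ p) x = ≈-trans (+-congˡ (*-congˡ (eval-neg p x)))
    (solve 3 (λ a x p → :- a :+ x :* (:- p) := :- (a :+ x :* p)) ≈-refl a x (eval p x))

  eval-const : ∀ a x → eval (constᴾ a) x ≈ a
  eval-const a x = ≈-trans (+-congˡ (zeroʳ x)) (+-identityʳ a)

  eval-X : ∀ x → eval Xᴾ x ≈ x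
  eval-X x = ≈-trans (+-identityˡ _) (≈-trans (*-congˡ (eval-const 1# x)) (*-identityʳ x))

  eval-^ : ∀ p x k → eval (p Pᴹ.^ k) x ≈ eval p x Kᴹ.^ k
  eval-^ p x zero    = eval-const 1# x
  eval-^ p x (suc k) = ≈-trans (eval-* p (p Pᴹ.^ k) x) (*-congˡ (eval-^ p x k))

  eval-sum : ∀ {n} (p : Fin n → Polynomial) x → eval (Pᴹ.sum p) x ≈ sum (λ i → eval (p i) x)
  eval-sum {zero}  p x = ≈-refl
  eval-sum {suc n} p x = ≈-trans (eval-+ (p zero) _ x) (+-congˡ (eval-sum (p ∘ suc) x))

  eval-product : ∀ {n} (p : Fin n → Polynomial) x →
    eval (Pᴹ.product p) x ≈ Kᴹ.product (λ i → eval (p i) x)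
  eval-product {zero}  p x = eval-const 1# x
  eval-product {suc n} p x = ≈-trans (eval-* (p zero) _ x) (*-congˡ (eval-product (p ∘ suc) x))

  eval-det : ∀ {n} (A : Mᴾ.Matrix n n) x → eval (Mᴾ.det A) x ≈ det (λ i j → eval (A i j) x)
  eval-det {zero}  A x = eval-const 1# x
  eval-det {suc n} A x = begin
    eval (Mᴾ.det A) x
      ≈⟨ eval-sum term x ⟩
    sum (λ j → eval (term j) x)
      ≈⟨ sum-cong-≋ (λ j → ≈-trans (eval-* (sign j) (A zero j *ᴾ Mᴾ.det (minorᴾ j)) x) (*-cong (eval-sign j)
           (≈-trans (eval-* (A zero j) (Mᴾ.det (minorᴾ j)) x) (*-congˡ (eval-det (minorᴾ j) x))))) ⟩
    det (λ i j → eval (A i j) x)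
      ∎
    where
    minorᴾ : Fin (suc n) → Mᴾ.Matrix n n
    minorᴾ j i k = A (suc i) (punchIn j k)
    sign term : Fin (suc n) → Polynomial
    sign j = map -_ (constᴾ 1#) Pᴹ.^ toℕ j
    term j = sign j *ᴾ (A zero j *ᴾ Mᴾ.det (minorᴾ j))
    power-cong : ∀ k {a b} → a ≈ b → a Kᴹ.^ k ≈ b Kᴹ.^ k
    power-cong zero    a≈b = ≈-refl
    power-cong (suc k) a≈b = *-cong a≈b (power-cong k a≈b)
    eval-sign : ∀ j → eval (sign j) x ≈ (- 1#) Kᴹ.^ toℕ j
    eval-sign j = ≈-trans (eval-^ (map -_ (constᴾ 1#)) x (toℕ j))
      (power-cong (toℕ j) (eval-const (- 1#) x))

  -- The coefficients of (X p(X) - x p(x)) / (X - x).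
  divide : Polynomial → Carrier → Polynomial
  divide []      x = []
  divide (a ∷ p) x = eval (a ∷ p) x ∷ divide p x

  eval-divide : ∀ p x y →
    y * eval p y - x * eval p x ≈ (y - x) * eval (divide p x) y
  eval-divide []      x y =
    solve 2 (λ x y → y :* con (ℤ.+ 0) :- x :* con (ℤ.+ 0) := (y :- x) :* con (ℤ.+ 0)) ≈-refl x y
  eval-divide (a ∷ p) x y = begin
    y * (a + y * py) - x * (a + x * px)
      ≈⟨ solve 5 (λ a x y px py → y :* (a :+ y :* py) :- x :* (a :+ x :* px) :=
           (y :- x) :* (a :+ x :* px) :+ y :* (y :* py :- x :* px)) ≈-refl a x y px py ⟩
    (y - x) * (a + x * px) + y * (y * py - x * px)
      ≈⟨ +-congˡ (*-congˡ (eval-divide p x y)) ⟩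
    (y - x) * (a + x * px) + y * ((y - x) * q)
      ≈⟨ solve 6 (λ a x y px q d → d :* (a :+ x :* px) :+ y :* (d :* q) :=
           d :* (a :+ x :* px :+ y :* q)) ≈-refl a x y px q (y - x) ⟩
    (y - x) * (a + x * px + y * q)
      ∎
    where
    px py q : Carrier
    px = eval p x
    py = eval p y
    q = eval (divide p x) y

  length-divide : ∀ p x → length (divide p x) ≡ length p
  length-divide []      x = refl
  length-divide (a ∷ p) x = ≡.cong suc (length-divide p x)

  -- Works from the top coefficient down: once p vanishes, the leading entry a + x p(x) of the list
  -- reduces to a.
  divide-≈[] : ∀ p x → divide p x ≈ᴾ [] → p ≈ᴾ []
  divide-≈[] []      x q≈0 k = ≈-refl
  divide-≈[] (a ∷ p) x q≈0 = λ { zero → a≈0 ; (suc k) → p≈0 k }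
    where
    p≈0 : p ≈ᴾ []
    p≈0 = divide-≈[] p x (q≈0 ∘ suc)
    a≈0 : a ≈ 0#
    a≈0 = begin
      a                  ≈⟨ +-identityʳ a ⟨
      a + 0#             ≈⟨ +-congˡ (zeroʳ x) ⟨
      a + x * 0#         ≈⟨ +-congˡ (*-congˡ (eval-≈[] p x p≈0)) ⟨
      a + x * eval p x   ≈⟨ q≈0 zero ⟩
      0#                 ∎

  -- A polynomial vanishing at all integers from m on vanishes: divide by X - m.
  eval-zero-from : ∀ n p → length p ≡ n → ∀ m → (∀ k → eval p (fromℕ (m ℕ.+ k)) ≈ 0#) → p ≈ᴾ []
  eval-zero-from n       []      len m vanish k = ≈-refl
  eval-zero-from (suc n) (a ∷ p) len m vanish = λ { zero → a≈0 ; (suc k) → p≈0 k }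
    where
    x₀ : Carrier
    x₀ = fromℕ m

    vanish₀ : eval (a ∷ p) x₀ ≈ 0#
    vanish₀ = ≈-trans (reflexive (≡.cong (eval (a ∷ p) ∘ fromℕ) (≡.sym (ℕ.+-identityʳ m)))) (vanish 0)

    -- From m + 1 on, the divisor X - m takes the values k + 1, which can be cancelled.
    vanish′ : ∀ k → eval (divide p x₀) (fromℕ (suc m ℕ.+ k)) ≈ 0#
    vanish′ k = *-cancelˡ-0 (fromℕ≉0 (suc k)) (begin
      fromℕ (suc k) * eval (divide p x₀) x
        ≈⟨ *-congʳ difference ⟨
      (x - x₀) * eval (divide p x₀) x
        ≈⟨ eval-divide p x₀ x ⟨
      x * eval p x - x₀ * eval p x₀
        ≈⟨ solve 5 (λ a x px y py → x :* px :- y :* py := a :+ x :* px :- (a :+ y :* py))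
             ≈-refl a x (eval p x) x₀ (eval p x₀) ⟩
      eval (a ∷ p) x - eval (a ∷ p) x₀
        ≈⟨ x≈y⇒x-y≈0 (≈-trans vanishₓ (≈-sym vanish₀)) ⟩
      0# ∎)
      where
      x : Carrier
      x = fromℕ (suc m ℕ.+ k)
      shift : suc m ℕ.+ k ≡ m ℕ.+ suc k
      shift = ≡.sym (ℕ.+-suc m k)
      vanishₓ : eval (a ∷ p) x ≈ 0#
      vanishₓ = ≈-trans (reflexive (≡.cong (eval (a ∷ p) ∘ fromℕ) shift)) (vanish (suc k))
      difference : x - x₀ ≈ fromℕ (suc k)
      difference = begin
        x - x₀                            ≡⟨ ≡.cong (λ n → fromℕ n - x₀) shift ⟩
        fromℕ (m ℕ.+ suc k) - x₀          ≈⟨ +-congʳ (fromℕ-+ m (suc k)) ⟩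
        (x₀ + fromℕ (suc k)) - x₀         ≈⟨ solve 2 (λ x y → x :+ y :- x := y) ≈-refl x₀ (fromℕ (suc k)) ⟩
        fromℕ (suc k)                     ∎

    p≈0 : p ≈ᴾ []
    -- The recursion is on the length: the quotient of `a ∷ p` by X - m is `divide p x₀`, as long as
    -- `p` but not a subterm.
    p≈0 = divide-≈[] p x₀ (eval-zero-from n (divide p x₀)
      (≡.trans (length-divide p x₀) (ℕ.suc-injective len)) (suc m) vanish′)

    a≈0 : a ≈ 0#
    a≈0 = begin
      a                    ≈⟨ solve 2 (λ a x → a := a :+ x :* con (ℤ.+ 0)) ≈-refl a x₀ ⟩
      a + x₀ * 0#          ≈⟨ +-congˡ (*-congˡ (eval-≈[] p x₀ p≈0)) ⟨
      a + x₀ * eval p x₀   ≈⟨ vanish₀ ⟩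
      0#                   ∎

  -- The natural numbers are distinct in the field, so they already give more zeros of p - q than a
  -- nonzero polynomial can have.
  eval-injective : ∀ p q → (∀ x → eval p x ≈ eval q x) → p ≈ᴾ q
  eval-injective p q p≈q k = x-y≈0⇒x≈y (begin
    coeff p k - coeff q k          ≈⟨ +-congˡ (coeff-neg q k) ⟨
    coeff p k + coeff (map -_ q) k ≈⟨ coeff-+ p (map -_ q) k ⟨
    coeff (p +ᴾ map -_ q) k        ≈⟨ eval-zero-from _ (p +ᴾ map -_ q) refl 0 (λ n → difference (fromℕ n)) k ⟩
    0#                             ∎)
    where
    coeff-neg : ∀ p k → coeff (map -_ p) k ≈ - coeff p k
    coeff-neg []      k       = ≈-sym -0#≈0#
    coeff-neg (a ∷ p) zero    = ≈-refl
    coeff-neg (a ∷ p) (suc k) = coeff-neg p k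
    coeff-+ : ∀ p q k → coeff (p +ᴾ q) k ≈ coeff p k + coeff q k
    coeff-+ []      q       k       = ≈-sym (+-identityˡ _)
    coeff-+ (a ∷ p) []      k       = ≈-sym (+-identityʳ _)
    coeff-+ (a ∷ p) (b ∷ q) zero    = ≈-refl
    coeff-+ (a ∷ p) (b ∷ q) (suc k) = coeff-+ p q k
    difference : ∀ x → eval (p +ᴾ map -_ q) x ≈ 0#
    difference x = ≈-trans (eval-+ p (map -_ q) x)
      (≈-trans (+-congˡ (eval-neg q x)) (x≈y⇒x-y≈0 (p≈q x)))

  ≈[]-stable : ∀ p → ¬ ¬ (p ≈ᴾ []) → p ≈ᴾ []
  ≈[]-stable p ¬p≉0 k = decidable-stable (coeff p k ≈? 0#) λ pk≉0 → ¬p≉0 λ p≈0 → pk≉0 (p≈0 k)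

  -- Pointwise cancellation fails where q vanishes. Instead the product is zero as a function, hence
  -- as a polynomial, and polynomials over a field have no zero divisors.
  eval-cancelʳ : ∀ p q → ¬ (q ≈ᴾ []) → (∀ x → eval p x * eval q x ≈ 0#) → ∀ x → eval p x ≈ 0#
  eval-cancelʳ p q q≉0 pq≈0 x = eval-≈[] p x (≈[]-stable p λ p≉0 →
    -- The numerators are dummies: the point is that the product of two nonzero denominators is
    -- nonzero.
    *-den≉0 ([] / p [ p≉0 ]) ([] / q [ q≉0 ])
      (eval-injective (p *ᴾ q) [] λ x → ≈-trans (eval-* p q x) (pq≈0 x)))

  eval-characteristicMatrix : ∀ {n} (A : Matrix n n) x i j →
    eval (characteristicMatrix A i j) x ≈ diagonal (λ _ → x) i j - A i j
  eval-characteristicMatrix A x i j with does (i ≟ j)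
  ... | true  = ≈-trans (eval-+ Xᴾ (map -_ (constᴾ (A i j))) x) (+-cong (eval-X x) (eval-const (- A i j) x))
  ... | false = ≈-trans (eval-const (- A i j) x) (≈-sym (+-identityˡ _))

  ∑-diagonal : ∀ {n} (d v : Fin n → Carrier) i → ∑[ j < n ] (diagonal d i j * v j) ≈ d i * v i
  ∑-diagonal {suc n} d v zero    =
    ≈-trans (+-congˡ (∑-zero λ j → zeroˡ (v (suc j)))) (+-identityʳ _)
  ∑-diagonal {suc n} d v (suc i) = ≈-trans (+-cong (zeroˡ _)
    (≈-trans (sum-cong-≋ λ j → *-congʳ (shift i j)) (∑-diagonal (d ∘ suc) (v ∘ suc) i))) (+-identityˡ _)
    where
    shift : ∀ i j → diagonal d (suc i) (suc j) ≈ diagonal (d ∘ suc) i j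
    shift i j with i ≟ j
    ... | yes _ = ≈-refl
    ... | no  _ = ≈-refl

  ∑-minus : ∀ {n} (f g : Fin n → Carrier) → ∑[ i < n ] (f i - g i) ≈ ∑[ i < n ] f i - ∑[ i < n ] g i
  ∑-minus f g = ≈-trans (∑-distrib-+ f (λ i → - g i)) (+-congˡ (∑-neg g))

  characteristic-*ⱽ : ∀ {n} (A : Matrix n n) x v i →
    ((λ i j → eval (characteristicMatrix A i j) x) *ⱽ v) i ≈ x * v i - (A *ⱽ v) i
  characteristic-*ⱽ {n} A x v i = begin
    ∑[ j < n ] (eval (characteristicMatrix A i j) x * v j)
      ≈⟨ sum-cong-≋ (λ j → ≈-trans (*-congʳ (eval-characteristicMatrix A x i j))
           (solve 3 (λ d a v → (d :- a) :* v := d :* v :- a :* v) ≈-refl (diagonal (λ _ → x) i j) (A i j) (v j))) ⟩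
    ∑[ j < n ] (diagonal (λ _ → x) i j * v j - A i j * v j)
      ≈⟨ ∑-minus (λ j → diagonal (λ _ → x) i j * v j) (λ j → A i j * v j) ⟩
    ∑[ j < n ] (diagonal (λ _ → x) i j * v j) - (A *ⱽ v) i
      ≈⟨ +-congʳ (∑-diagonal (λ _ → x) v i) ⟩
    x * v i - (A *ⱽ v) i
      ∎

  product≈0 : ∀ {n} (f : Fin n → Carrier) → Kᴹ.product f ≈ 0# → ∃ λ i → f i ≈ 0#
  product≈0 {zero}  f 1≈0 = contradiction 1≈0 1≉0
  product≈0 {suc n} f f≈0 with f zero ≈? 0#
  ... | yes f₀≈0 = zero , f₀≈0
  ... | no  f₀≉0 with product≈0 (f ∘ suc) (*-cancelˡ-0 f₀≉0 f≈0)
  ...   | i , fi≈0 = suc i , fi≈0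

  factor≈0 : ∀ {n} (f : Fin n → Carrier) i → f i ≈ 0# → Kᴹ.product f ≈ 0#
  factor≈0 f zero    f₀≈0 = ≈-trans (*-congʳ f₀≈0) (zeroˡ _)
  factor≈0 f (suc i) fi≈0 = ≈-trans (*-congˡ (factor≈0 (f ∘ suc) i fi≈0)) (zeroʳ _)

  -- The listed spectrum against eigenvectors.

  module _ {n} {A : Matrix n n} {μ : Fin n → Carrier} (spectrum : IsSpectrum A μ) where
    private
      characteristicDet : ∀ x →
        det (λ i j → eval (characteristicMatrix A i j) x) ≈ Kᴹ.product (λ i → eval (Xᴾ +ᴾ constᴾ (- μ i)) x)
      characteristicDet x = begin
        det (λ i j → eval (characteristicMatrix A i j) x)
          ≈⟨ eval-det (characteristicMatrix A) x ⟨
        eval (Mᴾ.det (characteristicMatrix A)) x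
          ≈⟨ eval-cong (Mᴾ.det (characteristicMatrix A)) (Pᴹ.product (λ i → Xᴾ +ᴾ constᴾ (- μ i))) x spectrum ⟩
        eval (Pᴹ.product (λ i → Xᴾ +ᴾ constᴾ (- μ i))) x
          ≈⟨ eval-product (λ i → Xᴾ +ᴾ constᴾ (- μ i)) x ⟩
        Kᴹ.product (λ i → eval (Xᴾ +ᴾ constᴾ (- μ i)) x)
          ∎

      eval-factor : ∀ x i → eval (Xᴾ +ᴾ constᴾ (- μ i)) x ≈ x - μ i
      eval-factor x i = ≈-trans (eval-+ Xᴾ (constᴾ (- μ i)) x) (+-cong (eval-X x) (eval-const _ x))

    -- An eigenvector is a kernel vector of x I - A, so the product of the x - μ i is 0, and in a
    -- field one factor is 0.
    eigenvalue⇒spectrum : ∀ {x} → IsEigenvalue A x → ∃ λ i → x ≈ μ i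
    eigenvalue⇒spectrum {x} (v , v≉0 , Av≈xv) =
      let i , eq = product≈0 (λ i → eval (Xᴾ +ᴾ constᴾ (- μ i)) x) (≈-trans (≈-sym (characteristicDet x))
            (kernel⇒det≈0 (λ i j → eval (characteristicMatrix A i j) x) (v , ¬∀⟶∃¬ n _ (λ i → v i ≈? 0#) v≉0 , λ i →
              ≈-trans (characteristic-*ⱽ A x v i) (x≈y⇒x-y≈0 (≈-sym (Av≈xv i))))))
      in i , x-y≈0⇒x≈y (≈-trans (≈-sym (eval-factor x i)) eq)

    -- At x = μ i the factorization makes the characteristic matrix singular, and a kernel vector of
    -- it is the eigenvector that is lifted to the product later.
    spectrum⇒eigenvalue : ∀ i → IsEigenvalue A (μ i)
    spectrum⇒eigenvalue i with det≈0⇒kernel (λ j k → eval (characteristicMatrix A j k) (μ i))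
      (≈-trans (characteristicDet (μ i)) (factor≈0 _ i
        (≈-trans (eval-factor (μ i) i) (-‿inverseʳ (μ i)))))
    ... | v , (j , vj≉0) , eq = v , (λ v≈0 → vj≉0 (v≈0 j)) , λ k →
      ≈-sym (x-y≈0⇒x≈y (≈-trans (≈-sym (characteristic-*ⱽ A (μ i) v k)) (eq k)))

-- Values of rational functions, and the coronal as n / X.

module Coronal {c ℓ₁ ℓ₂} (K : RealClosedField c ℓ₁ ℓ₂) where
  open RealClosedField K
  open Spectral K
  open Arithmetic K
  open Evaluation K
  open Sum semiring
  open SetoidReasoning setoid
  open Solver using (solve; _:=_; _:+_; _:*_; _:-_; :-_; con)
  private
    module R = RawRing rationalFunctionField
    module Rᴹ = RawSemiringDefinitions (RawRing.rawSemiring rationalFunctionField)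
    module Mᴿ = Matrices rationalFunctionField

  -- The value read from this very representative, in contrast to `_⟨_⟩↦_`. Sums and products
  -- multiply denominators without reducing, so values are carried along concrete fractions.
  HasValue : RationalFunction → Carrier → Carrier → Set ℓ₁
  HasValue f x y = eval (den f) x ≉ 0# × eval (num f) x ≈ y * eval (den f) x

  value : ∀ f x → eval (den f) x ≉ 0# → ∃ (HasValue f x)
  value f x d≉0 with inverse (eval (den f) x) d≉0
  ... | d⁻¹ , dd⁻¹≈1 = eval (num f) x * d⁻¹ , d≉0 , ≈-sym (begin
    eval (num f) x * d⁻¹ * d     ≈⟨ *-assoc _ _ _ ⟩
    eval (num f) x * (d⁻¹ * d)   ≈⟨ *-congˡ (≈-trans (*-comm _ _) dd⁻¹≈1) ⟩
    eval (num f) x * 1#          ≈⟨ *-identityʳ _ ⟩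
    eval (num f) x               ∎)
    where d = eval (den f) x

  value-+ : ∀ f g {x y z} → HasValue f x y → HasValue g x z → HasValue (f R.+ g) x (y + z)
  value-+ f g {x} {y} {z} (df≉0 , f≈y) (dg≉0 , g≈z) =
    (λ eq → *-≉0 df≉0 dg≉0 (≈-trans (≈-sym (eval-* (den f) (den g) x)) eq)) , (begin
    eval (num f *ᴾ den g +ᴾ num g *ᴾ den f) x
      ≈⟨ eval-+ (num f *ᴾ den g) (num g *ᴾ den f) x ⟩
    eval (num f *ᴾ den g) x + eval (num g *ᴾ den f) x
      ≈⟨ +-cong (≈-trans (eval-* (num f) (den g) x) (*-congʳ f≈y))
                (≈-trans (eval-* (num g) (den f) x) (*-congʳ g≈z)) ⟩
    y * eval (den f) x * eval (den g) x + z * eval (den g) x * eval (den f) x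
      ≈⟨ solve 4 (λ y z d e → y :* d :* e :+ z :* e :* d := (y :+ z) :* (d :* e)) ≈-refl
           y z (eval (den f) x) (eval (den g) x) ⟩
    (y + z) * (eval (den f) x * eval (den g) x)
      ≈⟨ *-congˡ (eval-* (den f) (den g) x) ⟨
    (y + z) * eval (den f *ᴾ den g) x
      ∎)

  value-* : ∀ f g {x y z} → HasValue f x y → HasValue g x z → HasValue (f R.* g) x (y * z)
  value-* f g {x} {y} {z} (df≉0 , f≈y) (dg≉0 , g≈z) =
    (λ eq → *-≉0 df≉0 dg≉0 (≈-trans (≈-sym (eval-* (den f) (den g) x)) eq)) , (begin
    eval (num f *ᴾ num g) x
      ≈⟨ ≈-trans (eval-* (num f) (num g) x) (*-cong f≈y g≈z) ⟩
    y * eval (den f) x * (z * eval (den g) x)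
      ≈⟨ solve 4 (λ y z d e → y :* d :* (z :* e) := y :* z :* (d :* e)) ≈-refl
           y z (eval (den f) x) (eval (den g) x) ⟩
    y * z * (eval (den f) x * eval (den g) x)
      ≈⟨ *-congˡ (eval-* (den f) (den g) x) ⟨
    y * z * eval (den f *ᴾ den g) x
      ∎)

  value-polynomial : ∀ p x → HasValue (polynomial p) x (eval p x)
  value-polynomial p x =
    (λ eq → 1≉0 (≈-trans (≈-sym (eval-const 1# x)) eq)) ,
    ≈-sym (≈-trans (*-congˡ (eval-const 1# x)) (*-identityʳ _))

  value-sum : ∀ {n} (f : Fin n → RationalFunction) {x} {y : Fin n → Carrier} →
    (∀ i → HasValue (f i) x (y i)) → HasValue (Rᴹ.sum f) x (sum y)
  value-sum {zero}  f {x} f↦y = value-polynomial [] x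
  value-sum {suc n} f f↦y =
    value-+ (f zero) (Rᴹ.sum (f ∘ suc)) (f↦y zero) (value-sum (f ∘ suc) (f↦y ∘ suc))

  -- The denominator of a sum is the product of all denominators. Hence every entry of the inverse
  -- matrix has a value wherever the denominator of its entry sum is nonzero.
  den-sum : ∀ {n} (f : Fin n → RationalFunction) x →
    eval (den (Rᴹ.sum f)) x ≉ 0# → ∀ i → eval (den (f i)) x ≉ 0#
  den-sum {suc n} f x d≉0 i = go i
    where
    split : eval (den (Rᴹ.sum f)) x ≈ eval (den (f zero)) x * eval (den (Rᴹ.sum (f ∘ suc))) x
    split = eval-* (den (f zero)) (den (Rᴹ.sum (f ∘ suc))) x
    go : ∀ i → eval (den (f i)) x ≉ 0#
    go zero    eq = d≉0 (≈-trans split (≈-trans (*-congʳ eq) (zeroˡ _)))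
    go (suc i) = den-sum (f ∘ suc) x
      (λ eq → d≉0 (≈-trans split (≈-trans (*-congˡ eq) (zeroʳ _)))) i

  ≈ᴿ-eval : ∀ f g → f ≈ᴿ g → ∀ x → eval (num f) x * eval (den g) x ≈ eval (num g) x * eval (den f) x
  ≈ᴿ-eval f g f≈g x = begin
    eval (num f) x * eval (den g) x   ≈⟨ eval-* (num f) (den g) x ⟨
    eval (num f *ᴾ den g) x           ≈⟨ eval-cong (num f *ᴾ den g) (num g *ᴾ den f) x f≈g ⟩
    eval (num g *ᴾ den f) x           ≈⟨ eval-* (num g) (den f) x ⟩
    eval (num g) x * eval (den f) x   ∎

  value-unique : ∀ f g {x y z} → f ≈ᴿ g → HasValue f x y → HasValue g x z → y ≈ z
  value-unique f g {x} {y} {z} f≈g (df≉0 , f≈y) (dg≉0 , g≈z) = *-cancelˡ (*-≉0 df≉0 dg≉0) (begin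
    df * dg * y       ≈⟨ solve 3 (λ d e y → d :* e :* y := y :* d :* e) ≈-refl df dg y ⟩
    y * df * dg       ≈⟨ *-congʳ f≈y ⟨
    eval (num f) x * dg  ≈⟨ ≈ᴿ-eval f g f≈g x ⟩
    eval (num g) x * df  ≈⟨ *-congʳ g≈z ⟩
    z * dg * df       ≈⟨ solve 3 (λ d e z → z :* e :* d := d :* e :* z) ≈-refl df dg z ⟩
    df * dg * z       ∎)
    where
    df dg : Carrier
    df = eval (den f) x
    dg = eval (den g) x

  value-identity : ∀ {n} (i j : Fin n) x → HasValue (Mᴿ.identity i j) x (identity i j)
  value-identity i j x with does (i ≟ j)
  ... | true  = let d≉0 , eq = value-polynomial (constᴾ 1#) x in
                d≉0 , ≈-trans eq (*-congʳ (eval-const 1# x))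
  ... | false = value-polynomial [] x

  ∑-ones : ∀ {n} (A : Fin n → Carrier) → ∑[ j < n ] (A j * 1#) ≈ sum A
  ∑-ones A = sum-cong-≋ λ j → *-identityʳ (A j)

  -- The numerator of X f - n: it is the zero polynomial exactly when f equals n / X.
  X*num-n*den : ℕ → RationalFunction → Polynomial
  X*num-n*den n f = Xᴾ *ᴾ num f +ᴾ map -_ (constᴾ (fromℕ n) *ᴾ den f)

  eval-X*num-n*den : ∀ n f x →
    eval (X*num-n*den n f) x ≈ x * eval (num f) x - fromℕ n * eval (den f) x
  eval-X*num-n*den n f x =
    ≈-trans (eval-+ (Xᴾ *ᴾ num f) (map -_ (constᴾ (fromℕ n) *ᴾ den f)) x) (+-cong
      (≈-trans (eval-* Xᴾ (num f) x) (*-congʳ (eval-X x)))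
      (≈-trans (eval-neg (constᴾ (fromℕ n) *ᴾ den f) x)
        (-‿cong (≈-trans (eval-* (constᴾ (fromℕ n)) (den f) x) (*-congʳ (eval-const (fromℕ n) x))))))

  -- The columns of x I - A sum to x 𝟏 when A 𝟏 = 0, so 𝟏ᵀ B (x I - A) 𝟏 = n
  -- reads x 𝟏ᵀ B 𝟏 = n. It is checked at the points where no denominator vanishes,
  -- and extends from there to an identity of polynomials.
  coronal-eval : ∀ {n} {A : Matrix n n} → (∀ i → sum (A i) ≈ 0#) → ∀ {χ} → IsCoronal A χ →
    ∀ x → x * eval (num χ) x ≈ fromℕ n * eval (den χ) x
  coronal-eval {n} {A} A𝟏≈0 {χ} (B , _ , B⟨xI-A⟩≈I , χ≈) x = x-y≈0⇒x≈y (≈-trans (≈-sym (eval-X*num-n*den n χ x))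
    (eval-cancelʳ p (den χ *ᴾ den E) (*-den≉0 χ E) p*d≈0 x))
    where
    E : RationalFunction
    E = Mᴿ.entrySum B

    p : Polynomial
    p = X*num-n*den n χ

    module AtRegularPoint (x : Carrier) (dχ≉0 : eval (den χ) x ≉ 0#) (dE≉0 : eval (den E) x ≉ 0#) where
      C : Matrix n n
      C i j = eval (characteristicMatrix A i j) x

      C𝟏≈x : ∀ i → sum (C i) ≈ x
      C𝟏≈x i = begin
        sum (C i)                          ≈⟨ ∑-ones (C i) ⟨
        ∑[ j < n ] (C i j * 1#)            ≈⟨ characteristic-*ⱽ A x (λ _ → 1#) i ⟩
        x * 1# - ∑[ j < n ] (A i j * 1#)   ≈⟨ +-cong (*-identityʳ x) (-‿cong (≈-trans (∑-ones (A i)) (A𝟏≈0 i))) ⟩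
        x - 0#                             ≈⟨ solve 1 (λ x → x :- con (ℤ.+ 0) := x) ≈-refl x ⟩
        x                                  ∎

      entry : ∀ i j → ∃ (HasValue (B i j) x)
      entry i j = value (B i j) x (den-sum (B i) x (den-sum (λ i → Rᴹ.sum (B i)) x dE≉0 i) j)

      b : Matrix n n
      b i j = proj₁ (entry i j)

      bC≈I : ∀ i k → (b *ᴹ C) i k ≈ identity i k
      bC≈I i k = value-unique (Rᴹ.sum BC) (Mᴿ.identity i k) (B⟨xI-A⟩≈I i k)
        (value-sum BC (λ j → value-* (B i j) (polynomial (characteristicMatrix A j k)) (proj₂ (entry i j)) (value-polynomial (characteristicMatrix A j k) x)))
        (value-identity i k x)
        where
        BC : Fin n → RationalFunction
        BC j = B i j R.* polynomial (characteristicMatrix A j k)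

      row : ∀ i → sum (b i) * x ≈ 1#
      row i = begin
        sum (b i) * x                              ≈⟨ *-distribʳ-sum x (b i) ⟩
        ∑[ j < n ] (b i j * x)                     ≈⟨ sum-cong-≋ (λ j → *-congˡ (≈-sym (C𝟏≈x j))) ⟩
        ∑[ j < n ] (b i j * sum (C j))             ≈⟨ sum-cong-≋ (λ j → *-distribˡ-sum (b i j) (C j)) ⟩
        ∑[ j < n ] ∑[ k < n ] (b i j * C j k)      ≈⟨ ∑-comm (λ j k → b i j * C j k) ⟩
        ∑[ k < n ] (b *ᴹ C) i k                    ≈⟨ sum-cong-≋ (bC≈I i) ⟩
        ∑[ k < n ] identity i k                    ≈⟨ ∑-ones (identity i) ⟨
        ∑[ k < n ] (identity i k * 1#)             ≈⟨ ∑-diagonal (λ _ → 1#) (λ _ → 1#) i ⟩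
        1# * 1#                                    ≈⟨ *-identityˡ 1# ⟩
        1#                                         ∎

      total : entrySum b * x ≈ fromℕ n
      total = begin
        entrySum b * x                  ≈⟨ *-distribʳ-sum x (λ i → sum (b i)) ⟩
        ∑[ i < n ] (sum (b i) * x)      ≈⟨ sum-cong-≋ row ⟩
        ∑[ i < n ] 1#                   ≈⟨ ∑-constant n 1# ⟩
        fromℕ n * 1#                    ≈⟨ *-identityʳ _ ⟩
        fromℕ n                         ∎

      χ-value : HasValue χ x (proj₁ (value χ x dχ≉0))
      χ-value = proj₂ (value χ x dχ≉0)

      χ≈b : proj₁ (value χ x dχ≉0) ≈ entrySum b
      χ≈b = value-unique χ E χ≈ χ-value
        (value-sum (λ i → Rᴹ.sum (B i)) λ i → value-sum (B i) λ j → proj₂ (entry i j))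

      p≈0 : eval p x ≈ 0#
      p≈0 = ≈-trans (eval-X*num-n*den n χ x) (x≈y⇒x-y≈0 (begin
        x * eval (num χ) x                  ≈⟨ *-congˡ (proj₂ χ-value) ⟩
        x * (y * eval (den χ) x)            ≈⟨ solve 3 (λ x y d → x :* (y :* d) := y :* x :* d) ≈-refl x y (eval (den χ) x) ⟩
        y * x * eval (den χ) x              ≈⟨ *-congʳ (≈-trans (*-congʳ χ≈b) total) ⟩
        fromℕ n * eval (den χ) x            ∎))
        where y = proj₁ (value χ x dχ≉0)

    -- The factor makes the product vanish at the excluded points as well, so the identity holds
    -- everywhere and the factor can be cancelled as a polynomial.
    p*d≈0 : ∀ x → eval p x * eval (den χ *ᴾ den E) x ≈ 0#
    p*d≈0 x with eval (den χ) x ≈? 0# | eval (den E) x ≈? 0#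
    ... | no dχ≉0 | no dE≉0 = ≈-trans (*-congʳ (AtRegularPoint.p≈0 x dχ≉0 dE≉0)) (zeroˡ _)
    ... | yes dχ≈0 | _ = ≈-trans (*-congˡ (≈-trans (eval-* (den χ) (den E) x)
                           (≈-trans (*-congʳ dχ≈0) (zeroˡ _)))) (zeroʳ _)
    ... | no _ | yes dE≈0 = ≈-trans (*-congˡ (≈-trans (eval-* (den χ) (den E) x)
                              (≈-trans (*-congˡ dE≈0) (zeroʳ _)))) (zeroʳ _)

  -- The value comes from some representative g, and the denominator of χ may vanish at x. So x num
  -- g = n den g is shown at all points by cancelling den χ as a polynomial; only then is den g
  -- divided out at x.
  coronal-value : ∀ {n} {A : Matrix n n} → (∀ i → sum (A i) ≈ 0#) → ∀ {χ} → IsCoronal A χ →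
    ∀ {x y} → χ ⟨ x ⟩↦ y → x * y ≈ fromℕ n
  coronal-value {n} {A} A𝟏≈0 {χ} coronal {x} {y} (g , g≈χ , dg≉0 , g↦y) = *-cancelˡ dg≉0 (begin
    eval (den g) x * (x * y)
      ≈⟨ solve 3 (λ d x y → d :* (x :* y) := x :* (y :* d)) ≈-refl (eval (den g) x) x y ⟩
    x * (y * eval (den g) x)
      ≈⟨ *-congˡ g↦y ⟨
    x * eval (num g) x
      ≈⟨ x-y≈0⇒x≈y (≈-trans (≈-sym (eval-X*num-n*den n g x)) (eval-cancelʳ p (den χ) (den≉0 χ) p*d≈0 x)) ⟩
    fromℕ n * eval (den g) x
      ≈⟨ *-comm _ _ ⟩
    eval (den g) x * fromℕ n
      ∎)
    where
    p : Polynomial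
    p = X*num-n*den n g

    p*d≈0 : ∀ x → eval p x * eval (den χ) x ≈ 0#
    p*d≈0 x = begin
      eval p x * dχ                               ≈⟨ *-congʳ (eval-X*num-n*den n g x) ⟩
      (x * ng - fromℕ n * dg) * dχ                ≈⟨ solve 5 (λ x ng n dg dχ →
                                                       (x :* ng :- n :* dg) :* dχ := x :* (ng :* dχ) :- dg :* (n :* dχ))
                                                       ≈-refl x ng (fromℕ n) dg dχ ⟩
      x * (ng * dχ) - dg * (fromℕ n * dχ)         ≈⟨ +-cong (*-congˡ (≈ᴿ-eval g χ g≈χ x))
                                                       (-‿cong (*-congˡ (≈-sym (coronal-eval A𝟏≈0 {χ} coronal x)))) ⟩
      x * (nχ * dg) - dg * (x * nχ)               ≈⟨ solve 3 (λ x nχ dg → x :* (nχ :* dg) :- dg :* (x :* nχ) := con (ℤ.+ 0))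
                                                       ≈-refl x nχ dg ⟩
      0#                                          ∎
      where
      ng dg nχ dχ : Carrier
      ng = eval (num g) x
      dg = eval (den g) x
      nχ = eval (num χ) x
      dχ = eval (den χ) x

  -- Whatever fraction χ is given as, its representative n / X has a nonzero denominator at every x
  -- ≠ 0.
  value-coronal : ∀ {n} {A : Matrix n n} → (∀ i → sum (A i) ≈ 0#) → ∀ {χ} → IsCoronal A χ →
    ∀ {x y} → x ≉ 0# → x * y ≈ fromℕ n → χ ⟨ x ⟩↦ y
  value-coronal {n} {A} A𝟏≈0 {χ} coronal {x} {y} x≉0 xy≈n =
    n/X , eval-injective (num n/X *ᴾ den χ) (num χ *ᴾ Xᴾ) n/X≈χ , (λ eq → x≉0 (≈-trans (≈-sym (eval-X x)) eq)) , (begin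
      eval (constᴾ (fromℕ n)) x   ≈⟨ eval-const (fromℕ n) x ⟩
      fromℕ n                     ≈⟨ xy≈n ⟨
      x * y                       ≈⟨ *-comm x y ⟩
      y * x                       ≈⟨ *-congˡ (eval-X x) ⟨
      y * eval Xᴾ x               ∎)
    where
    n/X : RationalFunction
    n/X = constᴾ (fromℕ n) / Xᴾ [ (λ X≈0 → 1≉0 (X≈0 1)) ]
    n/X≈χ : ∀ x → eval (constᴾ (fromℕ n) *ᴾ den χ) x ≈ eval (num χ *ᴾ Xᴾ) x
    n/X≈χ x = begin
      eval (constᴾ (fromℕ n) *ᴾ den χ) x           ≈⟨ eval-* (constᴾ (fromℕ n)) (den χ) x ⟩
      eval (constᴾ (fromℕ n)) x * eval (den χ) x   ≈⟨ *-congʳ (eval-const (fromℕ n) x) ⟩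
      fromℕ n * eval (den χ) x                     ≈⟨ coronal-eval A𝟏≈0 {χ} coronal x ⟨
      x * eval (num χ) x                           ≈⟨ *-comm _ _ ⟩
      eval (num χ) x * x                           ≈⟨ *-congˡ (eval-X x) ⟨
      eval (num χ) x * eval Xᴾ x                   ≈⟨ eval-* (num χ) Xᴾ x ⟨
      eval (num χ *ᴾ Xᴾ) x                         ∎

-- Laplacian matrices as sums of differences.

module Laplacian {c ℓ₁ ℓ₂} (K : RealClosedField c ℓ₁ ℓ₂) where
  open RealClosedField K
  open Spectral K
  open Arithmetic K
  open Evaluation K
  open Sum semiring
  open SetoidReasoning setoid
  open Solver using (solve; _:=_; _:+_; _:*_; _:-_; :-_; con)

  fromℕ-degree : ∀ {n} (G : Graph n) i → fromℕ (degree G i) ≈ sum (adjacencyMatrix G i)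
  fromℕ-degree {n} G i = go id
    where
    -- `allFin` is `tabulate id`; the induction needs an arbitrary function in place of `id`.
    go : ∀ {m} (f : Fin m → Fin n) →
      fromℕ (count (Graph.adjacent? G i) (tabulate f)) ≈ ∑[ j < m ] adjacencyMatrix G i (f j)
    go {zero}  f = ≈-refl
    go {suc m} f with does (Graph.adjacent? G i (f zero))
    ... | true  = +-congˡ (go (f ∘ suc))
    ... | false = ≈-trans (go (f ∘ suc)) (≈-sym (+-identityˡ _))

  adjacencyMatrix-symmetric : ∀ {n} (G : Graph n) i j → adjacencyMatrix G i j ≡ adjacencyMatrix G j i
  adjacencyMatrix-symmetric G i j = ≡.cong (if_then 1# else 0#)
    (does-⇔ (mk⇔ symmetric symmetric) (adjacent? i j) (adjacent? j i))
    where open Graph G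

  -- In this form degrees disappear, so the Laplacian of the product can be computed from its
  -- adjacencies alone.
  laplacian-*ⱽ : ∀ {n} (G : Graph n) v i →
    (laplacian G *ⱽ v) i ≈ ∑[ j < n ] (adjacencyMatrix G i j * (v i - v j))
  laplacian-*ⱽ {n} G v i = begin
    ∑[ j < n ] ((D i j - A i j) * v j)
      ≈⟨ sum-cong-≋ (λ j → solve 3 (λ d a v → (d :- a) :* v := d :* v :- a :* v) ≈-refl (D i j) (A i j) (v j)) ⟩
    ∑[ j < n ] (D i j * v j - A i j * v j)
      ≈⟨ ∑-minus (λ j → D i j * v j) (λ j → A i j * v j) ⟩
    ∑[ j < n ] (D i j * v j) - ∑[ j < n ] (A i j * v j)
      ≈⟨ +-congʳ (≈-trans (∑-diagonal (fromℕ ∘ degree G) v i)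
           (≈-trans (*-congʳ (fromℕ-degree G i)) (*-distribʳ-sum (v i) (A i)))) ⟩
    ∑[ j < n ] (A i j * v i) - ∑[ j < n ] (A i j * v j)
      ≈⟨ ∑-minus (λ j → A i j * v i) (λ j → A i j * v j) ⟨
    ∑[ j < n ] (A i j * v i - A i j * v j)
      ≈⟨ sum-cong-≋ (λ j → solve 3 (λ a v w → a :* v :- a :* w := a :* (v :- w)) ≈-refl (A i j) (v i) (v j)) ⟩
    ∑[ j < n ] (A i j * (v i - v j))
      ∎
    where
    A D : Matrix n n
    A = adjacencyMatrix G
    D = diagonal (fromℕ ∘ degree G)

  laplacian-constant : ∀ {n} (G : Graph n) x i → (laplacian G *ⱽ λ _ → x) i ≈ 0#
  laplacian-constant G x i = ≈-trans (laplacian-*ⱽ G (λ _ → x) i)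
    (∑-zero λ j → ≈-trans (*-congˡ {adjacencyMatrix G i j} (-‿inverseʳ x)) (zeroʳ _))

  laplacian-row-sum : ∀ {n} (G : Graph n) i → sum (laplacian G i) ≈ 0#
  laplacian-row-sum G i =
    ≈-trans (sum-cong-≋ λ j → ≈-sym (*-identityʳ (laplacian G i j))) (laplacian-constant G 1# i)

  -- By symmetry the columns sum to 0 as the rows do. This removes L(G₂) when the equations at the
  -- b's are summed.
  laplacian-sum : ∀ {n} (G : Graph n) v → ∑[ i < n ] (laplacian G *ⱽ v) i ≈ 0#
  laplacian-sum {n} G v = begin
    ∑[ i < n ] (laplacian G *ⱽ v) i
      ≈⟨ ∑-comm (λ i j → laplacian G i j * v j) ⟩
    ∑[ j < n ] ∑[ i < n ] (laplacian G i j * v j)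
      ≈⟨ ∑-zero (λ j → ≈-trans (≈-sym (*-distribʳ-sum (v j) (λ i → laplacian G i j)))
           (≈-trans (*-congʳ (≈-trans (sum-cong-≋ λ i → symmetric i j) (laplacian-row-sum G j))) (zeroˡ _))) ⟩
    0#
      ∎
    where
    symmetric : ∀ i j → laplacian G i j ≈ laplacian G j i
    symmetric i j = +-cong diagonal-symmetric (-‿cong (reflexive (adjacencyMatrix-symmetric G i j)))
      where
      diagonal-symmetric : diagonal (fromℕ ∘ degree G) i j ≈ diagonal (fromℕ ∘ degree G) j i
      diagonal-symmetric with i ≟ j | j ≟ i
      ... | yes refl | yes _   = ≈-refl
      ... | yes refl | no  i≢i = contradiction refl i≢i
      ... | no  i≢i  | yes refl = contradiction refl i≢i
      ... | no  _    | no  _   = ≈-refl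

  ∑-↑ : ∀ m {n} (f : Fin (m ℕ.+ n) → Carrier) →
    sum f ≈ ∑[ i < m ] f (i ↑ˡ n) + ∑[ j < n ] f (m ↑ʳ j)
  ∑-↑ zero    f = ≈-sym (+-identityˡ _)
  ∑-↑ (suc m) f = ≈-trans (+-congˡ (∑-↑ m (f ∘ suc))) (≈-sym (+-assoc _ _ _))

  ∑-combine : ∀ m {n} (f : Fin (m ℕ.* n) → Carrier) →
    sum f ≈ ∑[ i < m ] ∑[ k < n ] f (combine i k)
  ∑-combine zero        f = ≈-refl
  ∑-combine (suc m) {n} f = ≈-trans (∑-↑ n f) (+-congˡ (∑-combine m (λ i → f (n ↑ʳ i))))

  -- The Laplacian of the product, acting on functions of its vertices.

  module Product {n₁ n₂} (G₁ : Graph n₁) (G₂ : Graph n₂) where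
    open GraphProduct G₁ G₂ using (Vertex; a; b; vertex; adjacent?)

    index : Vertex → Fin (n₁ ℕ.* n₂ ℕ.+ n₁ ℕ.* n₂)
    index (a i k) = join (n₁ ℕ.* n₂) (n₁ ℕ.* n₂) (inj₁ (combine i k))
    index (b i k) = join (n₁ ℕ.* n₂) (n₁ ℕ.* n₂) (inj₂ (combine i k))

    vertex-index : ∀ w → vertex (index w) ≡ w
    vertex-index (a i k) = ≡.trans
      (≡.cong [ uncurry a ∘ remQuot n₂ , uncurry b ∘ remQuot n₂ ]′ (splitAt-join (n₁ ℕ.* n₂) (n₁ ℕ.* n₂) (inj₁ (combine i k))))
      (≡.cong (uncurry a) (remQuot-combine i k))
    vertex-index (b i k) = ≡.trans
      (≡.cong [ uncurry a ∘ remQuot n₂ , uncurry b ∘ remQuot n₂ ]′ (splitAt-join (n₁ ℕ.* n₂) (n₁ ℕ.* n₂) (inj₂ (combine i k))))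
      (≡.cong (uncurry b) (remQuot-combine i k))

    index-vertex : ∀ u → index (vertex u) ≡ u
    index-vertex u = ≡.trans (join-combine (splitAt (n₁ ℕ.* n₂) u)) (join-splitAt (n₁ ℕ.* n₂) _ u)
      where
      join-combine : ∀ s → index ([ uncurry a ∘ remQuot n₂ , uncurry b ∘ remQuot n₂ ]′ s) ≡
                           join (n₁ ℕ.* n₂) (n₁ ℕ.* n₂) s
      join-combine (inj₁ w) = ≡.cong (join (n₁ ℕ.* n₂) (n₁ ℕ.* n₂) ∘ inj₁) (combine-remQuot {n₁} n₂ w)
      join-combine (inj₂ w) = ≡.cong (join (n₁ ℕ.* n₂) (n₁ ℕ.* n₂) ∘ inj₂) (combine-remQuot {n₁} n₂ w)

    adjacency : Vertex → Vertex → Carrier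
    adjacency w w′ = if does (adjacent? w w′) then 1# else 0#

    -- Acting on functions of `Vertex` frees the computations below from the numbering of the
    -- vertices.
    laplacianᵛ : (Vertex → Carrier) → Vertex → Carrier
    laplacianᵛ f w =
      ∑[ i < n₁ ] ∑[ k < n₂ ] (adjacency w (a i k) * (f w - f (a i k))) +
      ∑[ i < n₁ ] ∑[ k < n₂ ] (adjacency w (b i k) * (f w - f (b i k)))

    laplacian-vertex : ∀ f u → (laplacian (G₁ ⊛ G₂) *ⱽ (f ∘ vertex)) u ≈ laplacianᵛ f (vertex u)
    laplacian-vertex f u = begin
      (laplacian (G₁ ⊛ G₂) *ⱽ (f ∘ vertex)) u
        ≈⟨ laplacian-*ⱽ (G₁ ⊛ G₂) (f ∘ vertex) u ⟩
      sum (λ u′ → term (vertex u′))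
        ≈⟨ ∑-↑ (n₁ ℕ.* n₂) (λ u′ → term (vertex u′)) ⟩
      ∑[ i < n₁ ℕ.* n₂ ] term (vertex (join _ _ (inj₁ i))) + ∑[ i < n₁ ℕ.* n₂ ] term (vertex (join (n₁ ℕ.* n₂) _ (inj₂ i)))
        ≈⟨ +-cong (∑-combine n₁ (λ i → term (vertex (join _ _ (inj₁ i)))))
                  (∑-combine n₁ (λ i → term (vertex (join (n₁ ℕ.* n₂) _ (inj₂ i))))) ⟩
      ∑[ i < n₁ ] ∑[ k < n₂ ] term (vertex (index (a i k))) + ∑[ i < n₁ ] ∑[ k < n₂ ] term (vertex (index (b i k)))
        ≈⟨ +-cong (sum-cong-≋ λ i → sum-cong-≋ λ k → reflexive (≡.cong term (vertex-index (a i k))))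
                  (sum-cong-≋ λ i → sum-cong-≋ λ k → reflexive (≡.cong term (vertex-index (b i k)))) ⟩
      laplacianᵛ f (vertex u)
        ∎
      where
      term : Vertex → Carrier
      term w = adjacency (vertex u) w * (f (vertex u) - f w)

    IsEigenvalueᵛ : Carrier → Set _
    IsEigenvalueᵛ x = ∃ λ f → (∃ λ w → f w ≉ 0#) × (∀ w → laplacianᵛ f w ≈ x * f w)

    fromVertices : ∀ {x} → IsEigenvalueᵛ x → IsEigenvalue (laplacian (G₁ ⊛ G₂)) x
    fromVertices (f , (w , fw≉0) , eq) =
      f ∘ vertex ,
      (λ f≈0 → fw≉0 (≈-trans (reflexive (≡.cong f (≡.sym (vertex-index w)))) (f≈0 (index w)))) ,
      λ u → ≈-trans (laplacian-vertex f u) (eq (vertex u))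

    toVertices : ∀ {x} → IsEigenvalue (laplacian (G₁ ⊛ G₂)) x → IsEigenvalueᵛ x
    toVertices {x} (v , v≉0 , eq) with ¬∀⟶∃¬ _ _ (λ u → v u ≈? 0#) v≉0
    ... | u , vu≉0 =
      v ∘ index ,
      (vertex u , λ eq → vu≉0 (≈-trans (reflexive (≡.cong v (≡.sym (index-vertex u)))) eq)) ,
      λ w → ≡.subst (λ w → laplacianᵛ (v ∘ index) w ≈ x * v (index w)) (vertex-index w) (begin
        laplacianᵛ (v ∘ index) (vertex (index w))
          ≈⟨ laplacian-vertex (v ∘ index) (index w) ⟨
        (laplacian (G₁ ⊛ G₂) *ⱽ (v ∘ index ∘ vertex)) (index w)
          ≈⟨ sum-cong-≋ (λ u → *-congˡ (reflexive (≡.cong v (index-vertex u)))) ⟩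
        (laplacian (G₁ ⊛ G₂) *ⱽ v) (index w)
          ≈⟨ eq (index w) ⟩
        x * v (index w)
          ≡⟨ ≡.cong (λ u → x * v u) (index-vertex (index w)) ⟨
        x * v (index (vertex (index w)))
          ∎)

    adjacency-aa : ∀ i k j l → adjacency (a i k) (a j l) ≡ adjacencyMatrix G₁ i j
    adjacency-aa i k j l with Graph.adjacent? G₁ i j
    ... | yes _ = refl
    ... | no  _ = refl

    adjacency-ab : ∀ i p j q → adjacency (a i p) (b j q) ≡ identity i j
    adjacency-ab i p j q with i ≟ j
    ... | yes refl = refl
    ... | no  _    = refl

    adjacency-ba : ∀ i q j p → adjacency (b i q) (a j p) ≡ identity i j
    adjacency-ba i q j p with i ≟ j
    ... | yes refl = refl
    ... | no  _    = refl

    adjacency-bb : ∀ r i s j → adjacency (b r i) (b s j) ≈ identity r s * adjacencyMatrix G₂ i j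
    adjacency-bb r i s j with r ≟ s
    ... | no  _    = ≈-sym (zeroˡ _)
    ... | yes refl with Graph.adjacent? G₂ i j
    ...   | yes _ = ≈-sym (*-identityˡ _)
    ...   | no  _ = ≈-sym (*-identityˡ _)

    ∑-identity : ∀ {n} (f : Fin n → Carrier) i → ∑[ j < n ] (identity i j * f j) ≈ f i
    ∑-identity f i = ≈-trans (∑-diagonal (λ _ → 1#) f i) (*-identityˡ (f i))

    ∑-const-minus : ∀ {n} x (f : Fin n → Carrier) → ∑[ k < n ] (x - f k) ≈ fromℕ n * x - sum f
    ∑-const-minus {n} x f = ≈-trans (∑-minus (λ _ → x) f) (+-congʳ (∑-constant n x))

    module _ (f : Vertex → Carrier) where
      A B : Fin n₁ → Carrier
      A i = ∑[ k < n₂ ] f (a i k)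
      B i = ∑[ k < n₂ ] f (b i k)

      -- Whether two a's are adjacent depends only on their first indices, so the other a's enter
      -- only through the sums `A j`, and the b's through `B i`.
      laplacianᵛ-a : ∀ i k → laplacianᵛ f (a i k) ≈
        ∑[ j < n₁ ] (adjacencyMatrix G₁ i j * (fromℕ n₂ * f (a i k) - A j)) +
        (fromℕ n₂ * f (a i k) - B i)
      laplacianᵛ-a i k = +-cong
        (sum-cong-≋ λ j → begin
          ∑[ l < n₂ ] (adjacency (a i k) (a j l) * (f (a i k) - f (a j l)))
            ≈⟨ sum-cong-≋ (λ l → *-congʳ (reflexive (adjacency-aa i k j l))) ⟩
          ∑[ l < n₂ ] (adjacencyMatrix G₁ i j * (f (a i k) - f (a j l)))
            ≈⟨ *-distribˡ-sum (adjacencyMatrix G₁ i j) (λ l → f (a i k) - f (a j l)) ⟨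
          adjacencyMatrix G₁ i j * ∑[ l < n₂ ] (f (a i k) - f (a j l))
            ≈⟨ *-congˡ (∑-const-minus (f (a i k)) (λ l → f (a j l))) ⟩
          adjacencyMatrix G₁ i j * (fromℕ n₂ * f (a i k) - A j)
            ∎)
        (begin
          ∑[ j < n₁ ] ∑[ q < n₂ ] (adjacency (a i k) (b j q) * (f (a i k) - f (b j q)))
            ≈⟨ sum-cong-≋ (λ j → sum-cong-≋ λ q → *-congʳ (reflexive (adjacency-ab i k j q))) ⟩
          ∑[ j < n₁ ] ∑[ q < n₂ ] (identity i j * (f (a i k) - f (b j q)))
            ≈⟨ sum-cong-≋ (λ j → *-distribˡ-sum (identity i j) (λ q → f (a i k) - f (b j q))) ⟨
          ∑[ j < n₁ ] (identity i j * ∑[ q < n₂ ] (f (a i k) - f (b j q)))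
            ≈⟨ ∑-identity (λ j → ∑[ q < n₂ ] (f (a i k) - f (b j q))) i ⟩
          ∑[ q < n₂ ] (f (a i k) - f (b i q))
            ≈⟨ ∑-const-minus (f (a i k)) (λ q → f (b i q)) ⟩
          fromℕ n₂ * f (a i k) - B i
            ∎)

      -- L(G₂) acts on each row of b's separately, and the a's enter only through `A r`; when that
      -- sum is 0, the rows decouple.
      laplacianᵛ-b : ∀ r q → laplacianᵛ f (b r q) ≈
        (laplacian G₂ *ⱽ λ l → f (b r l)) q + (fromℕ n₂ * f (b r q) - A r)
      laplacianᵛ-b r q = ≈-trans (+-comm _ _) (+-cong
        (begin
          ∑[ s < n₁ ] ∑[ l < n₂ ] (adjacency (b r q) (b s l) * (f (b r q) - f (b s l)))
            ≈⟨ sum-cong-≋ (λ s → sum-cong-≋ λ l → ≈-trans (*-congʳ (adjacency-bb r q s l)) (*-assoc _ _ _)) ⟩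
          ∑[ s < n₁ ] ∑[ l < n₂ ] (identity r s * (adjacencyMatrix G₂ q l * (f (b r q) - f (b s l))))
            ≈⟨ sum-cong-≋ (λ s → *-distribˡ-sum (identity r s) (λ l → adjacencyMatrix G₂ q l * (f (b r q) - f (b s l)))) ⟨
          ∑[ s < n₁ ] (identity r s * ∑[ l < n₂ ] (adjacencyMatrix G₂ q l * (f (b r q) - f (b s l))))
            ≈⟨ ∑-identity (λ s → ∑[ l < n₂ ] (adjacencyMatrix G₂ q l * (f (b r q) - f (b s l)))) r ⟩
          ∑[ l < n₂ ] (adjacencyMatrix G₂ q l * (f (b r q) - f (b r l)))
            ≈⟨ laplacian-*ⱽ G₂ (λ l → f (b r l)) q ⟨
          (laplacian G₂ *ⱽ λ l → f (b r l)) q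
            ∎)
        (begin
          ∑[ j < n₁ ] ∑[ p < n₂ ] (adjacency (b r q) (a j p) * (f (b r q) - f (a j p)))
            ≈⟨ sum-cong-≋ (λ j → sum-cong-≋ λ p → *-congʳ (reflexive (adjacency-ba r q j p))) ⟩
          ∑[ j < n₁ ] ∑[ p < n₂ ] (identity r j * (f (b r q) - f (a j p)))
            ≈⟨ sum-cong-≋ (λ j → *-distribˡ-sum (identity r j) (λ p → f (b r q) - f (a j p))) ⟨
          ∑[ j < n₁ ] (identity r j * ∑[ p < n₂ ] (f (b r q) - f (a j p)))
            ≈⟨ ∑-identity (λ j → ∑[ p < n₂ ] (f (b r q) - f (a j p))) r ⟩
          ∑[ p < n₂ ] (f (b r q) - f (a r p))
            ≈⟨ ∑-const-minus (f (b r q)) (λ p → f (a r p)) ⟩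
          fromℕ n₂ * f (b r q) - A r
            ∎))

      laplacianᵛ-a-sum : ∀ i → ∑[ k < n₂ ] laplacianᵛ f (a i k) ≈
        fromℕ n₂ * (laplacian G₁ *ⱽ A) i + (fromℕ n₂ * A i - fromℕ n₂ * B i)
      laplacianᵛ-a-sum i = begin
        ∑[ k < n₂ ] laplacianᵛ f (a i k)
          ≈⟨ sum-cong-≋ (laplacianᵛ-a i) ⟩
        ∑[ k < n₂ ] (∑[ j < n₁ ] (adj j * (m * α k - A j)) + (m * α k - B i))
          ≈⟨ ∑-distrib-+ (λ k → ∑[ j < n₁ ] (adj j * (m * α k - A j))) (λ k → m * α k - B i) ⟩
        ∑[ k < n₂ ] ∑[ j < n₁ ] (adj j * (m * α k - A j)) + ∑[ k < n₂ ] (m * α k - B i)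
          ≈⟨ +-cong (∑-comm (λ k j → adj j * (m * α k - A j))) (∑-linear (B i)) ⟩
        ∑[ j < n₁ ] ∑[ k < n₂ ] (adj j * (m * α k - A j)) + (m * A i - m * B i)
          ≈⟨ +-congʳ (sum-cong-≋ λ j → ≈-trans (≈-sym (*-distribˡ-sum (adj j) (λ k → m * α k - A j)))
               (≈-trans (*-congˡ (∑-linear (A j)))
               (solve 4 (λ c m x y → c :* (m :* x :- m :* y) := m :* (c :* (x :- y))) ≈-refl (adj j) m (A i) (A j)))) ⟩
        ∑[ j < n₁ ] (m * (adj j * (A i - A j))) + (m * A i - m * B i)
          ≈⟨ +-congʳ (≈-trans (≈-sym (*-distribˡ-sum m (λ j → adj j * (A i - A j))))
               (*-congˡ (≈-sym (laplacian-*ⱽ G₁ A i)))) ⟩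
        m * (laplacian G₁ *ⱽ A) i + (m * A i - m * B i)
          ∎
        where
        m : Carrier
        m = fromℕ n₂
        α : Fin n₂ → Carrier
        α k = f (a i k)
        adj : Fin n₁ → Carrier
        adj = adjacencyMatrix G₁ i
        ∑-linear : ∀ x → ∑[ k < n₂ ] (m * α k - x) ≈ m * A i - m * x
        ∑-linear x = ≈-trans (∑-minus (λ k → m * α k) (λ _ → x))
          (+-cong (≈-sym (*-distribˡ-sum m α)) (-‿cong (∑-constant n₂ x)))

      laplacianᵛ-b-sum : ∀ r → ∑[ q < n₂ ] laplacianᵛ f (b r q) ≈ fromℕ n₂ * B r - fromℕ n₂ * A r
      laplacianᵛ-b-sum r = begin
        ∑[ q < n₂ ] laplacianᵛ f (b r q)
          ≈⟨ sum-cong-≋ (laplacianᵛ-b r) ⟩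
        ∑[ q < n₂ ] ((laplacian G₂ *ⱽ β) q + (m * β q - A r))
          ≈⟨ ∑-distrib-+ (laplacian G₂ *ⱽ β) (λ q → m * β q - A r) ⟩
        ∑[ q < n₂ ] (laplacian G₂ *ⱽ β) q + ∑[ q < n₂ ] (m * β q - A r)
          ≈⟨ +-cong (laplacian-sum G₂ β) (∑-minus (λ q → m * β q) (λ _ → A r)) ⟩
        0# + (∑[ q < n₂ ] (m * β q) - ∑[ q < n₂ ] A r)
          ≈⟨ +-identityˡ _ ⟩
        ∑[ q < n₂ ] (m * β q) - ∑[ q < n₂ ] A r
          ≈⟨ +-cong (≈-sym (*-distribˡ-sum m β)) (-‿cong (∑-constant n₂ (A r))) ⟩
        m * B r - m * A r
          ∎
        where
        m : Carrier
        m = fromℕ n₂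
        β : Fin n₂ → Carrier
        β q = f (b r q)

-- Eigenvectors lifted to the product and projected from it.

module Integrality {c ℓ₁ ℓ₂} (K : RealClosedField c ℓ₁ ℓ₂) where
  open RealClosedField K
  open Spectral K
  open Arithmetic K
  open Evaluation K
  open Coronal K
  open Laplacian K
  open Sum semiring
  open SetoidReasoning setoid
  open Solver using (solve; _:=_; _:+_; _:*_; _:-_; :-_; con)

  nonZero⇒Fin : ∀ n .{{_ : NonZero n}} → Fin n
  nonZero⇒Fin (suc n) = zero

  x-y-integer⇒x-integer : ∀ {x} n → IsInteger (x - fromℕ n) → IsInteger x
  x-y-integer⇒x-integer {x} n x-n∈ℤ = IsInteger-resp-≈
    (solve 2 (λ x n → x :- n :+ n := x) ≈-refl x (fromℕ n))
    (IsInteger-+ x-n∈ℤ (IsInteger-fromℕ n))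

  module _ {n₁ n₂} .{{_ : NonZero n₁}} .{{_ : NonZero n₂}} (G₁ : Graph n₁) (G₂ : Graph n₂) where
    open GraphProduct G₁ G₂ using (Vertex; a; b)
    open Product G₁ G₂

    private
      m : Carrier
      m = fromℕ n₂

    -- v is copied to every row of b's, with 0 on the a's. The equations at the a's then demand
    -- `sum v ≈ 0#`, and the n₂ a-neighbours of each b raise the eigenvalue by n₂.
    eigenvalue-lift₂ : ∀ {x v} → (∃ λ i → v i ≉ 0#) → sum v ≈ 0# →
      (∀ i → (laplacian G₂ *ⱽ v) i ≈ x * v i) → IsEigenvalueᵛ (x + m)
    eigenvalue-lift₂ {x} {v} (i₀ , vi₀≉0) ∑v≈0 Lv≈xv = f , (b (nonZero⇒Fin n₁) i₀ , vi₀≉0) , eq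
      where
      f : Vertex → Carrier
      f (a _ _) = 0#
      f (b _ q) = v q
      A≈0 : ∀ i → A f i ≈ 0#
      A≈0 i = ∑-zero {n₂} λ _ → ≈-refl
      eq : ∀ w → laplacianᵛ f w ≈ (x + m) * f w
      eq (a i k) = begin
        laplacianᵛ f (a i k)
          ≈⟨ laplacianᵛ-a f i k ⟩
        ∑[ j < n₁ ] (adjacencyMatrix G₁ i j * (m * 0# - A f j)) + (m * 0# - sum v)
          ≈⟨ +-cong (∑-zero λ j → ≈-trans (*-congˡ {adjacencyMatrix G₁ i j} (m*0- (A≈0 j))) (zeroʳ _)) (m*0- ∑v≈0) ⟩
        0# + 0#
          ≈⟨ solve 1 (λ x → con (ℤ.+ 0) :+ con (ℤ.+ 0) := x :* con (ℤ.+ 0)) ≈-refl (x + m) ⟩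
        (x + m) * 0#
          ∎
        where
        m*0- : ∀ {y} → y ≈ 0# → m * 0# - y ≈ 0#
        m*0- y≈0 = ≈-trans (+-congˡ (-‿cong y≈0))
          (solve 1 (λ m → m :* con (ℤ.+ 0) :- con (ℤ.+ 0) := con (ℤ.+ 0)) ≈-refl m)
      eq (b r q) = begin
        laplacianᵛ f (b r q)
          ≈⟨ laplacianᵛ-b f r q ⟩
        (laplacian G₂ *ⱽ v) q + (m * v q - A f r)
          ≈⟨ +-cong (Lv≈xv q) (+-congˡ (-‿cong (A≈0 r))) ⟩
        x * v q + (m * v q - 0#)
          ≈⟨ solve 3 (λ x m v → x :* v :+ (m :* v :- con (ℤ.+ 0)) := (x :+ m) :* v) ≈-refl x m (v q) ⟩
        (x + m) * v q
          ∎

    eigenvalue₂-integer : LaplacianIntegral (G₁ ⊛ G₂) → LaplacianIntegral G₂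
    eigenvalue₂-integer integral x (v , v≉0 , Lv≈xv) with sum v ≈? 0#
    ... | yes ∑v≈0 = IsInteger-resp-≈
      (solve 2 (λ x m → x :+ m :- m := x) ≈-refl x m)
      (IsInteger-+
        (integral _ (fromVertices (eigenvalue-lift₂ (¬∀⟶∃¬ n₂ _ (λ i → v i ≈? 0#) v≉0) ∑v≈0 Lv≈xv)))
        (IsInteger-neg (IsInteger-fromℕ n₂)))
    -- An eigenvector not orthogonal to 𝟏 belongs to the eigenvalue 0.
    ... | no ∑v≉0 = IsInteger-resp-≈ (≈-sym x≈0) (IsInteger-fromℕ 0)
      where
      x≈0 : x ≈ 0#
      x≈0 = *-cancelʳ-0 ∑v≉0 (begin
        x * sum v                           ≈⟨ *-distribˡ-sum x v ⟩
        ∑[ i < n₂ ] (x * v i)               ≈⟨ sum-cong-≋ Lv≈xv ⟨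
        ∑[ i < n₂ ] (laplacian G₂ *ⱽ v) i   ≈⟨ laplacian-sum G₂ v ⟩
        0#                                  ∎)

    -- The two assumptions match the two kinds of vertices: the equations at the a's reduce to the
    -- root equation, those at the b's to t y = n₂.
    eigenvalue-lift₁ : ∀ {μ t y} → t * y ≈ m → t - m * μ - m * y ≈ 0# →
      IsEigenvalue (laplacian G₁) μ → IsEigenvalueᵛ (t + m)
    eigenvalue-lift₁ {μ} {t} {y} ty≈m root (u , u≉0 , Lu≈μu) =
      let j , uj≉0 = ¬∀⟶∃¬ n₁ _ (λ j → u j ≈? 0#) u≉0 in f , (a j (nonZero⇒Fin n₂) , uj≉0) , eq
      where
      f : Vertex → Carrier
      f (a i _) = u i
      -- Forced by the b's: a value β constant on row i satisfies m β - m u i = (t + m) β, so t β =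
      -- - m u i = - t y u i.
      f (b i _) = - y * u i
      t≈ : t ≈ m * μ + m * y
      t≈ = x-y≈0⇒x≈y (≈-trans (solve 3 (λ t p q → t :- (p :+ q) := t :- p :- q) ≈-refl t (m * μ) (m * y)) root)
      eq : ∀ w → laplacianᵛ f w ≈ (t + m) * f w
      eq (a i k) = begin
        laplacianᵛ f (a i k)
          ≈⟨ laplacianᵛ-a f i k ⟩
        ∑[ j < n₁ ] (adj j * (m * u i - A f j)) + (m * u i - B f i)
          ≈⟨ +-cong
               (sum-cong-≋ λ j → ≈-trans (*-congˡ {adj j} (+-congˡ (-‿cong (∑-constant n₂ (u j)))))
                 (solve 4 (λ c m x y → c :* (m :* x :- m :* y) := m :* (c :* (x :- y))) ≈-refl (adj j) m (u i) (u j)))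
               (+-congˡ (-‿cong (∑-constant n₂ (- y * u i)))) ⟩
        ∑[ j < n₁ ] (m * (adj j * (u i - u j))) + (m * u i - m * (- y * u i))
          ≈⟨ +-congʳ (≈-trans (≈-sym (*-distribˡ-sum m (λ j → adj j * (u i - u j))))
               (*-congˡ (≈-trans (≈-sym (laplacian-*ⱽ G₁ u i)) (Lu≈μu i)))) ⟩
        m * (μ * u i) + (m * u i - m * (- y * u i))
          ≈⟨ solve 4 (λ m μ y u → m :* (μ :* u) :+ (m :* u :- m :* (:- y :* u)) :=
               (m :* μ :+ m :* y :+ m) :* u) ≈-refl m μ y (u i) ⟩
        (m * μ + m * y + m) * u i
          ≈⟨ *-congʳ (+-congʳ t≈) ⟨
        (t + m) * u i
          ∎
        where
        adj : Fin n₁ → Carrier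
        adj = adjacencyMatrix G₁ i
      eq (b r q) = begin
        laplacianᵛ f (b r q)
          ≈⟨ laplacianᵛ-b f r q ⟩
        (laplacian G₂ *ⱽ λ _ → - y * u r) q + (m * (- y * u r) - A f r)
          ≈⟨ +-cong (laplacian-constant G₂ (- y * u r) q) (+-congˡ (-‿cong
               (≈-trans (∑-constant n₂ (u r)) (*-congʳ (≈-sym ty≈m))))) ⟩
        0# + (m * (- y * u r) - t * y * u r)
          ≈⟨ solve 4 (λ m t y u → con (ℤ.+ 0) :+ (m :* (:- y :* u) :- t :* y :* u) :=
               (t :+ m) :* (:- y :* u)) ≈-refl m t y (u r) ⟩
        (t + m) * (- y * u r)
          ∎

    eigenvalue-project₁ : ∀ {x} f → (∀ w → laplacianᵛ f w ≈ x * f w) →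
      (∃ λ i → A f i ≉ 0#) → x - m ≉ 0# →
      ∃₂ λ μ y → (x - m) * y ≈ m × x - m - m * μ - m * y ≈ 0# × IsEigenvalue (laplacian G₁) μ
    eigenvalue-project₁ {x} f Lf≈xf (i₀ , Ai₀≉0) t≉0 =
      μ , y , ty≈m , root , A f , (λ A≈0 → Ai₀≉0 (A≈0 i₀)) , LA≈μA
      where
      t t⁻¹ m⁻¹ y μ : Carrier
      t = x - m
      t⁻¹ = proj₁ (inverse t t≉0)
      m⁻¹ = proj₁ (inverse m (fromℕ≉0 n₂))
      -- y is the value of χ at t, and μ is solved from the root equation; that μ is an eigenvalue
      -- is then checked on `A f`.
      y = t⁻¹ * m
      μ = m⁻¹ * (t - m * y)

      ty≈m : t * y ≈ m
      ty≈m = ≈-trans (≈-sym (*-assoc _ _ _)) (≈-trans (*-congʳ (proj₂ (inverse t t≉0))) (*-identityˡ m))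

      mμ≈ : m * μ ≈ t - m * y
      mμ≈ = ≈-trans (≈-sym (*-assoc _ _ _)) (≈-trans (*-congʳ (proj₂ (inverse m (fromℕ≉0 n₂)))) (*-identityˡ _))

      root : t - m * μ - m * y ≈ 0#
      root = ≈-trans (+-congʳ (+-congˡ (-‿cong mμ≈)))
        (solve 2 (λ t z → t :- (t :- z) :- z := con (ℤ.+ 0)) ≈-refl t (m * y))

      -- The summed equations at the b's read t B = - m A; dividing by t gives the claim.
      B≈-yA : ∀ i → B f i ≈ - (y * A f i)
      B≈-yA i = *-cancelˡ t≉0 (begin
        (x - m) * B f i
          ≈⟨ solve 4 (λ x m B A → (x :- m) :* B := x :* B :- (m :* B :- m :* A) :- m :* A) ≈-refl x m (B f i) (A f i) ⟩
        x * B f i - (m * B f i - m * A f i) - m * A f i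
          ≈⟨ +-congʳ (x≈y⇒x-y≈0 (≈-trans (*-distribˡ-sum x (λ q → f (b i q)))
               (≈-trans (sum-cong-≋ (λ q → ≈-sym (Lf≈xf (b i q)))) (laplacianᵛ-b-sum f i)))) ⟩
        0# - m * A f i
          ≈⟨ +-congˡ (-‿cong (*-congʳ ty≈m)) ⟨
        0# - t * y * A f i
          ≈⟨ solve 3 (λ t y A → con (ℤ.+ 0) :- t :* y :* A := t :* (:- (y :* A))) ≈-refl t y (A f i) ⟩
        t * - (y * A f i)
          ∎)

      LA≈μA : ∀ i → (laplacian G₁ *ⱽ A f) i ≈ μ * A f i
      LA≈μA i = *-cancelˡ (fromℕ≉0 n₂) (begin
        m * l
          ≈⟨ solve 3 (λ p q r → p := p :+ (q :- r) :- (q :- r)) ≈-refl (m * l) (m * A f i) (m * B f i) ⟩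
        m * l + (m * A f i - m * B f i) - (m * A f i - m * B f i)
          ≈⟨ +-cong (≈-trans (≈-sym (laplacianᵛ-a-sum f i)) (≈-trans (sum-cong-≋ (λ k → Lf≈xf (a i k)))
               (≈-sym (*-distribˡ-sum x (λ k → f (a i k))))))
               (-‿cong (+-congˡ (-‿cong (*-congˡ (B≈-yA i))))) ⟩
        x * A f i - (m * A f i - m * - (y * A f i))
          ≈⟨ solve 4 (λ x m y A → x :* A :- (m :* A :- m :* (:- (y :* A))) := (x :- m :- m :* y) :* A) ≈-refl x m y (A f i) ⟩
        (t - m * y) * A f i
          ≈⟨ *-congʳ mμ≈ ⟨
        m * μ * A f i
          ≈⟨ *-assoc _ _ _ ⟩
        m * (μ * A f i)
          ∎)
        where
        l : Carrier
        l = (laplacian G₁ *ⱽ A f) i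

    eigenvalue-A≈0-integer : LaplacianIntegral G₂ → ∀ {x} f → (∀ w → laplacianᵛ f w ≈ x * f w) →
      (∃ λ w → f w ≉ 0#) → (∀ i → A f i ≈ 0#) → IsInteger x
    eigenvalue-A≈0-integer integral₂ {x} f Lf≈xf (w , fw≉0) A≈0
      with any? (λ r → any? (λ q → ¬? (f (b r q) ≈? 0#)))
    ... | yes (r , q , β≉0) = x-y-integer⇒x-integer n₂ (integral₂ (x - m)
      ((λ l → f (b r l)) , (λ β≈0 → β≉0 (β≈0 q)) , λ l → begin
        (laplacian G₂ *ⱽ λ l → f (b r l)) l
          ≈⟨ solve 3 (λ p q z → p := p :+ (q :- z) :- q :+ z) ≈-refl _ (m * f (b r l)) (A f r) ⟩
        (laplacian G₂ *ⱽ λ l → f (b r l)) l + (m * f (b r l) - A f r) - m * f (b r l) + A f r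
          ≈⟨ +-cong (+-congʳ (≈-trans (≈-sym (laplacianᵛ-b f r l)) (Lf≈xf (b r l)))) (A≈0 r) ⟩
        x * f (b r l) - m * f (b r l) + 0#
          ≈⟨ solve 3 (λ x m z → x :* z :- m :* z :+ con (ℤ.+ 0) := (x :- m) :* z) ≈-refl x m (f (b r l)) ⟩
        (x - m) * f (b r l)
          ∎))
    ... | no ∄β≉0 = at w fw≉0
      where
      β≈0 : ∀ r q → f (b r q) ≈ 0#
      β≈0 r q = decidable-stable (f (b r q) ≈? 0#) λ ≉0 → ∄β≉0 (r , q , ≉0)
      at : ∀ w → f w ≉ 0# → IsInteger x
      at (b r q) fw≉0 = contradiction (β≈0 r q) fw≉0
      -- The integer is the degree of `a i k`: n₂ a's for each neighbour of i, and n₂ b's. All sums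
      -- `A j` and `B i` vanish, so only this multiple of f remains.
      at (a i k) fw≉0 = IsInteger-resp-≈ (*-cancelˡ fw≉0 (begin
        α * fromℕ (degree G₁ i ℕ.* n₂ ℕ.+ n₂)
          ≈⟨ *-congˡ (≈-trans (fromℕ-+ (degree G₁ i ℕ.* n₂) n₂) (+-congʳ (≈-trans (fromℕ-* (degree G₁ i) n₂)
               (*-congʳ (fromℕ-degree G₁ i))))) ⟩
        α * (sum adj * m + m)
          ≈⟨ solve 3 (λ α s m → α :* (s :* m :+ m) := s :* (m :* α) :+ m :* α) ≈-refl α (sum adj) m ⟩
        sum adj * (m * α) + m * α
          ≈⟨ +-cong (≈-trans (*-distribʳ-sum (m * α) adj) (sum-cong-≋ λ j → *-congˡ (minus-0 (A≈0 j))))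
               (minus-0 (∑-zero (β≈0 i))) ⟩
        ∑[ j < n₁ ] (adj j * (m * α - A f j)) + (m * α - B f i)
          ≈⟨ laplacianᵛ-a f i k ⟨
        laplacianᵛ f (a i k)
          ≈⟨ Lf≈xf (a i k) ⟩
        x * α
          ≈⟨ *-comm x α ⟩
        α * x
          ∎)) (IsInteger-fromℕ (degree G₁ i ℕ.* n₂ ℕ.+ n₂))
        where
        α : Carrier
        α = f (a i k)
        adj : Fin n₁ → Carrier
        adj = adjacencyMatrix G₁ i
        minus-0 : ∀ {x y} → y ≈ 0# → x ≈ x - y
        minus-0 {x} y≈0 = ≈-trans (solve 1 (λ x → x := x :- con (ℤ.+ 0)) ≈-refl x) (+-congˡ (-‿cong (≈-sym y≈0)))

    module _ {μ₁ : Fin n₁ → Carrier} (spectrum : IsLaplacianSpectrum G₁ μ₁)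
             {χ : RationalFunction} (coronal : IsLaplacianCoronal G₂ χ) where

      -- A root comes with a value y of χ at x - n₂, so points where χ is undefined are not counted.
      RootsIntegral : Set _
      RootsIntegral = ∀ i x y → χ ⟨ x - m ⟩↦ y → x - m - m * μ₁ i - m * y ≈ 0# → IsInteger x

      integral⇒roots-integral : LaplacianIntegral (G₁ ⊛ G₂) → RootsIntegral
      integral⇒roots-integral integral i x y χ↦y root = IsInteger-resp-≈
        (solve 2 (λ x m → x :- m :+ m := x) ≈-refl x m)
        (integral (x - m + m) (fromVertices (eigenvalue-lift₁
          (coronal-value (laplacian-row-sum G₂) {χ} coronal χ↦y) root (spectrum⇒eigenvalue spectrum i))))

      roots-integral⇒integral : LaplacianIntegral G₂ → RootsIntegral → LaplacianIntegral (G₁ ⊛ G₂)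
      roots-integral⇒integral integral₂ roots x eigenvalue = integer (toVertices eigenvalue)
        where
        from-root : (∃₂ λ μ y → (x - m) * y ≈ m × x - m - m * μ - m * y ≈ 0# × IsEigenvalue (laplacian G₁) μ) →
          x - m ≉ 0# → IsInteger x
        from-root (μ , y , ty≈m , root , μ-eigenvalue) t≉0 =
          -- The condition on roots is indexed by the listed spectrum, so the eigenvalue μ has to be
          -- located in the list.
          let i , μ≈μᵢ = eigenvalue⇒spectrum spectrum μ-eigenvalue in
          roots i x y (value-coronal (laplacian-row-sum G₂) {χ} coronal t≉0 ty≈m)
            (≈-trans (+-congʳ (+-congˡ (-‿cong (*-congˡ (≈-sym μ≈μᵢ))))) root)

        integer : IsEigenvalueᵛ x → IsInteger x
        integer (f , f≉0 , Lf≈xf) with any? (λ i → ¬? (A f i ≈? 0#)) | x - m ≈? 0#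
        ... | no ∄A≉0 | _       = eigenvalue-A≈0-integer integral₂ f Lf≈xf f≉0 λ i →
          decidable-stable (A f i ≈? 0#) λ ≉0 → ∄A≉0 (i , ≉0)
        -- χ has no value at x - n₂ ≈ 0, so no root is available here; x ≈ n₂ is an integer already.
        ... | yes _   | yes t≈0 = IsInteger-resp-≈ (≈-sym (x-y≈0⇒x≈y t≈0)) (IsInteger-fromℕ n₂)
        ... | yes A≉0 | no t≉0  = from-root (eigenvalue-project₁ f Lf≈xf A≉0 t≉0) t≉0

theorem6 : ∀ {c ℓ₁ ℓ₂} (ℝ : RealClosedField c ℓ₁ ℓ₂) →
    let open RealClosedField ℝ
        open Spectral ℝ
    in
    (n₁ n₂ r₁ r₂ : ℕ) .{{_ : NonZero n₁}} .{{_ : NonZero n₂}}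
    (G₁ : Graph n₁) (G₂ : Graph n₂) →
    Regular r₁ G₁ → Regular r₂ G₂ →
    (μ₁ : Fin n₁ → Carrier) → IsLaplacianSpectrum G₁ μ₁ →
    (χ : RationalFunction) → IsLaplacianCoronal G₂ χ →
    LaplacianIntegral (G₁ ⊛ G₂) ⇔
      (LaplacianIntegral G₂ ×
       (∀ (i : Fin n₁) (x χ[x-n₂] : Carrier) →
          χ ⟨ x - fromℕ n₂ ⟩↦ χ[x-n₂] →
          x - fromℕ n₂ - fromℕ n₂ * μ₁ i - fromℕ n₂ * χ[x-n₂] ≈ 0# →
          IsInteger x))
theorem6 ℝ n₁ n₂ _ _ G₁ G₂ _ _ μ₁ spectrum χ coronal = mk⇔
  (λ integral → eigenvalue₂-integer G₁ G₂ integral ,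
                integral⇒roots-integral G₁ G₂ spectrum {χ} coronal integral)
  (λ (integral₂ , roots) → roots-integral⇒integral G₁ G₂ spectrum {χ} coronal integral₂ roots)
  where open Integrality ℝ
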